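{- Let $\Gamma$, $\omega$, $(\mathbb G,E)$ be as below with $\omega$ satisfying (C1) for every $f\in\Gamma$. Let $f\in\langle\Gamma\rangle$ have arity $n$ and let $x\in\mathrm{Range}_n(\mathbb G^*)\cap[\mathrm{dom} f]^m$. (a) $f^m(\mathbf g(x))=f^m(x)$ for every $\mathbf g\in\mathbb G$. (b) If in addition $\omega$ satisfies (C2) for every $f\in\Gamma$, then there exists a probability distribution $\lambda$ on $\mathbb G^*$, independent of $f$ and $x$, such that $f^\lambda_{i'}(x)=f^\lambda_{i''}(x)$ for all $i',i''\in[m]$, where $f^\lambda_i(x)=\sum_{\mathbf g\in\mathbb G^*}\lambda_{\mathbf g}f(g_i(x))$ and $g_i(x)$ denotes the $i$-th labeling of $\mathbf g(x)$.
   Context: $D$ finite, $m\ge2$, $\Gamma$ a finite set of cost functions $f:D^n\to\mathbb Q\cup\{\infty\}$, $\mathrm{dom} f=\{x:f(x)<\infty\}$. $\langle\Gamma\rangle$ (expressive power) is the set of functions $f(x_1,\dots,x_k)=\min_{x_{k+1},\dots,x_N}f_{\mathcal I}(x_1,\dots,x_N)$ for instances $\mathcal I$ of $\mathrm{VCSP}(\Gamma)$ on variables $x_1,\dots,x_N$, where $f_{\mathcal I}$ is a finite sum of functions of $\Gamma$ applied to tuples of these variables. $\mathcal O^{(m\to m)}$: maps $\mathbf g=(g_1,\dots,g_m):D^m\to D^m$, $\mathbb 1$ the identity. For $x=(x^1,\dots,x^m)\in[D^n]^m$, $\mathbf g(x)=(g_1(x),\dots,g_m(x))$ with $g_i$ applied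 coordinatewise; $f^m(x)=\frac1m\sum_i f(x^i)$; $x_{ -i}\in[D^n]^{m-1}$ is $x$ with $x^i$ removed and $f^{m-1}(x_{ -i})=\frac1{m-1}\sum_{j\ne i}f(x^j)$. $\omega$ is a finitely supported probability distribution, each $s\in\mathrm{supp}(\omega)$ associated with $\mathbb 1^s=(\mathbb 1^s_1,\dots,\mathbb 1^s_m)\in\mathcal O^{(m\to m)}$. (C1): $\sum_s\omega(s)f^m(\mathbb 1^s(x))\le f^m(x)$ for all $x\in[\mathrm{dom} f]^m$. (C2): $\sum_s\omega(s)f(\mathbb 1^s_i(x))\le f^{m-1}(x_{ -i})$ for all $x\in[\mathrm{dom} f]^m$, $i\in[m]$. $\mathbf g^s=\mathbb 1^s\circ\mathbf g$; $\mathbb G=\{\mathbb 1^{s_k}\circ\dots\circ\mathbb 1^{s_1}:k\ge0\}$; $E=\{(\mathbf g,\mathbf g^s):\mathbf g\in\mathbb G,s\in\mathrm{supp}(\omega)\}$; $\mathbb G^*$ is the union of strongly connected components of $(\mathbb G,E)$ with no outgoing edges; $\mathrm{Range}_n(\mathbb G^*)=\{\mathbf g^*(y):\mathbf g^*\in\mathbb G^*,y\in[D^n]^m\}$. -}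

module Defs where

open import Level using (Level; _⊔_; 0ℓ) renaming (suc to lsuc)
open import Algebra.Bundles using (CommutativeRing)
open import Algebra.Morphism.Structures using (IsRingHomomorphism)
open import Data.Fin.Base using (Fin)
import Data.Integer.Base as ℤ
open import Data.List.Base as List using (List; []; _∷_)
import Data.List.Extrema as Extrema
open import Data.List.Membership.Propositional using (_∈_)
open import Data.Maybe.Base as Maybe using ()
open import Data.Nat.Base using (ℕ; zero; suc; _+_)
open import Data.Product.Base using (Σ; ∃; ∃-syntax; _×_; _,_)
import Data.Rational.Base as ℚ
open import Data.Rational.Base using (ℚ; 0ℚ; 1ℚ)
import Data.Rational.Properties as ℚ
open import Data.Vec.Base as Vec using (Vec; []; _∷_; _++_; lookup; transpose; removeAt)
open import Data.Vec.Functional as Vector using (Vector)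
open import Data.Vec.Relation.Unary.All using (All)
open import Function.Base using (id; _∘_)
open import Relation.Binary.Bundles using (TotalOrder)
open import Relation.Binary.Core using (Rel)
open import Relation.Binary.Structures using (IsDecTotalOrder)
open import Relation.Binary.Construct.Closure.ReflexiveTransitive using (Star)
open import Relation.Binary.Construct.Union using (_∪_)
import Relation.Binary.Construct.Add.Supremum.Equality as Equality⁺
import Relation.Binary.Construct.Add.Supremum.NonStrict as NonStrict⁺
import Relation.Binary.Construct.Add.Supremum.Strict as Strict⁺
open import Relation.Binary.PropositionalEquality using (_≡_; refl; _≗_)
open import Relation.Nullary.Construct.Add.Supremum using (_⁺; ⊤⁺; [_])
open import Relation.Nullary.Negation.Core using (¬_)

-- Ordered field extensions of ℚ.  Costs are rational, but the weights of a
-- probability distribution range over such a K, so that rational weights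
-- (K = ℚ, see ℚ-orderedField) and real weights are covered uniformly.

record OrderedField (c ℓ₁ ℓ₂ : Level) : Set (lsuc (c ⊔ ℓ₁ ⊔ ℓ₂)) where
  infix 4 _≤_ _<_
  field
    commutativeRing : CommutativeRing c ℓ₁

  open CommutativeRing commutativeRing public renaming (_+_ to _⊕_; _*_ to _⊛_)

  field
    _≤_             : Rel Carrier ℓ₂
    isDecTotalOrder : IsDecTotalOrder _≈_ _≤_
    0≉1             : ¬ (0# ≈ 1#)
    invertible      : ∀ x → ¬ (x ≈ 0#) → ∃[ y ] (x ⊛ y) ≈ 1#
    +-monoˡ-≤       : ∀ z {x y} → x ≤ y → (x ⊕ z) ≤ (y ⊕ z)
    *-nonNeg        : ∀ {x y} → 0# ≤ x → 0# ≤ y → 0# ≤ (x ⊛ y)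
    ι               : ℚ → Carrier
    ι-homomorphism  : IsRingHomomorphism ℚ.+-*-rawRing rawRing ι
    ι-mono-≤        : ∀ {p q} → p ℚ.≤ q → ι p ≤ ι q

  _<_ : Rel Carrier (ℓ₁ ⊔ ℓ₂)
  x < y = x ≤ y × ¬ (x ≈ y)

  sum : ∀ {n} → Vector Carrier n → Carrier
  sum = Vector.foldr _⊕_ 0#

ℚ-orderedField : OrderedField 0ℓ 0ℓ 0ℓ
ℚ-orderedField = record
  { commutativeRing = ℚ.+-*-commutativeRing
  ; _≤_             = ℚ._≤_
  ; isDecTotalOrder = ℚ.≤-isDecTotalOrder
  ; 0≉1             = λ ()
  ; invertible      = λ x x≢0 → let instance nz = ℚ.≢-nonZero x≢0 in
                                (ℚ.1/ x) , ℚ.*-inverseʳ x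
  ; +-monoˡ-≤       = ℚ.+-monoˡ-≤
  ; *-nonNeg        = λ {x} {y} 0≤x 0≤y →
      let instance
            px = ℚ.nonNegative 0≤x
            py = ℚ.nonNegative 0≤y
            pxy = ℚ.nonNeg*nonNeg⇒nonNeg x y
      in ℚ.nonNegative⁻¹ (x ℚ.* y)
  ; ι               = id
  ; ι-homomorphism  = record
      { isSemiringHomomorphism = record
        { isNearSemiringHomomorphism = record
          { +-isMonoidHomomorphism = record
            { isMagmaHomomorphism = record
              { isRelHomomorphism = record { cong = id }
              ; homo = λ _ _ → refl }
            ; ε-homo = refl }
          ; *-homo = λ _ _ → refl }
        ; 1#-homo = refl }
      ; -‿homo = λ _ → refl }
  ; ι-mono-≤        = id
  }

-- A ⁺ is A extended by a top element ⊤⁺ (= ∞), which is absorbing for sums.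
sum⁺ : ∀ {a} {A : Set a} → (A → A → A) → A → ∀ {n} → Vector (A ⁺) n → A ⁺
sum⁺ _∙_ ε = Vector.foldr (Maybe.zipWith _∙_) [ ε ]

open Strict⁺ ℚ._<_ public using (_<⁺_)

ℚ⁺-totalOrder : TotalOrder 0ℓ 0ℓ 0ℓ
ℚ⁺-totalOrder = record
  { isTotalOrder = NonStrict⁺.≤⁺-isTotalOrder-≡ ℚ._≤_ ℚ.≤-isTotalOrder }

Labeling : ℕ → ℕ → Set
Labeling d n = Vec (Fin d) n

CostFn : ℕ → ℕ → Set
CostFn d n = Labeling d n → ℚ ⁺

Dom : ∀ {d n} → CostFn d n → Labeling d n → Set
Dom f x = f x <⁺ ⊤⁺

Language : ℕ → Set
Language d = List (∃[ n ] CostFn d n)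

record Constraint {d} (Γ : Language d) (N : ℕ) : Set where
  field
    {arity} : ℕ
    fn      : CostFn d arity
    fn∈Γ    : (arity , fn) ∈ Γ
    scope   : Vec (Fin N) arity

  value : Labeling d N → ℚ ⁺
  value x = fn (Vec.map (lookup x) scope)

Instance : ∀ {d} → Language d → ℕ → Set
Instance Γ N = ∃[ q ] Vector (Constraint Γ N) q

objective : ∀ {d N} {Γ : Language d} → Instance Γ N → CostFn d N
objective (_ , cs) x = sum⁺ ℚ._+_ 0ℚ (λ t → Constraint.value (cs t) x)

labelings : ∀ d n → List (Labeling d n)
labelings d zero    = [] ∷ []
labelings d (suc n) = List.cartesianProductWith _∷_ (List.allFin d) (labelings d n)

-- The expressive power ⟨ Γ ⟩: the first k variables are free, and the
-- remaining l variables are minimised out.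
⟨_⟩ : ∀ {d k} → Language d → CostFn d k → Set
⟨_⟩ {d} {k} Γ f = ∃[ l ] Σ (Instance Γ (k + l)) λ I → ∀ x →
  f x ≡ Extrema.min ℚ⁺-totalOrder ⊤⁺
          (List.map (λ y → objective I (x ++ y)) (labelings d l))

-- avg f (x¹ , … , xʳ) = (f x¹ + … + f xʳ) / r, for r = suc p.
avg : ∀ {d n p} → CostFn d n → Vec (Labeling d n) (suc p) → ℚ ⁺
avg {p = p} f xs =
  Maybe.map ((ℤ.+ 1 ℚ./ suc p) ℚ.*_) (sum⁺ ℚ._+_ 0ℚ (λ i → f (lookup xs i)))

Op : ℕ → ℕ → Set
Op d m = Vec (Fin d) m → Vec (Fin d) m

infix 25 _⟨_⟩ₙ

-- The i-th entry of transpose x is (x¹ᵢ , … , xᵐᵢ) ∈ D^m, to which g is applied.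
_⟨_⟩ₙ : ∀ {d m n} → Op d m → Vec (Labeling d n) m → Vec (Labeling d n) m
g ⟨ x ⟩ₙ = transpose (Vec.map g (transpose x))

module _ {c ℓ₁ ℓ₂} (K : OrderedField c ℓ₁ ℓ₂) where

  open OrderedField K

  -- A finite index set Fin size of support points with positive weights.
  -- Different indices may name the same point; their weights then add up.
  record Distribution (A : Set) : Set (c ⊔ ℓ₁ ⊔ ℓ₂) where
    field
      size     : ℕ
      point    : Fin size → A
      weight   : Fin size → Carrier
      weight>0 : ∀ s → 0# < weight s
      total≈1  : sum weight ≈ 1#

module _ {c ℓ₁ ℓ₂} {K : OrderedField c ℓ₁ ℓ₂} where

  open OrderedField K
  open NonStrict⁺ _≤_ using (_≤⁺_)

  -- Weights are positive, so w · ∞ = ∞ is the right convention.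
  𝔼 : ∀ {A} → Distribution K A → (A → ℚ ⁺) → Carrier ⁺
  𝔼 μ φ = sum⁺ _⊕_ 0# (λ s → Maybe.map (λ q → weight s ⊛ ι q) (φ (point s)))
    where open Distribution μ

  -- The support of ω is its index set, and point s is the operation 𝟙ˢ.

  C1 : ∀ {d p n} → Distribution K (Op d (suc p)) → CostFn d n → Set _
  C1 ω f = ∀ x → All (Dom f) x →
    𝔼 ω (λ 𝟙ˢ → avg f (𝟙ˢ ⟨ x ⟩ₙ)) ≤⁺ Maybe.map ι (avg f x)

  C2 : ∀ {d p n} → Distribution K (Op d (suc (suc p))) → CostFn d n → Set _
  C2 ω f = ∀ x → All (Dom f) x → ∀ i →
    𝔼 ω (λ 𝟙ˢ → f (lookup (𝟙ˢ ⟨ x ⟩ₙ) i)) ≤⁺ Maybe.map ι (avg f (removeAt x i))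

  module _ {d m} (ω : Distribution K (Op d m)) where

    open Distribution ω using (size) renaming (point to 𝟙)

    compose : List (Fin size) → Op d m
    compose []      = id
    compose (s ∷ w) = 𝟙 s ∘ compose w

    -- Maps are identified up to pointwise equality throughout, which is why
    -- 𝔾 and E are closed under _≗_ and paths may contain _≗_-steps.

    𝔾 : Op d m → Set
    𝔾 g = ∃[ w ] g ≗ compose w

    E : Rel (Op d m) 0ℓ
    E g h = 𝔾 g × ∃[ s ] h ≗ 𝟙 s ∘ g

    _⟶*_ : Rel (Op d m) 0ℓ
    _⟶*_ = Star (_≗_ ∪ E)

    StronglyConnected : Rel (Op d m) 0ℓ
    StronglyConnected g h = g ⟶* h × h ⟶* g

    -- No edge leaves the strongly connected component of g.
    𝔾* : Op d m → Set
    𝔾* g = 𝔾 g ×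
      (∀ {h h′} → StronglyConnected g h → E h h′ → StronglyConnected g h′)

    Range : ∀ n → Vec (Labeling d n) m → Set
    Range n x = ∃[ g ] 𝔾* g × ∃[ y ] x ≡ g ⟨ y ⟩ₙ

    expectedCost : ∀ {n} → Distribution K (∃ 𝔾*) → CostFn d n → Fin m → Vec (Labeling d n) m →
                   Carrier ⁺
    expectedCost μ f i x = 𝔼 μ (λ (g , _) → f (lookup (g ⟨ x ⟩ₙ) i))

  infix 4 _≈⁺_
  _≈⁺_ : Rel (Carrier ⁺) _
  _≈⁺_ = Equality⁺._≈⁺_ _≈_

module Submission where

-- With ω fixed, g ↦ 𝟙ˢ ∘ g is a finite Markov chain on 𝔾, and (C1) and (C2) pass from Γ to ⟨ Γ ⟩
-- because minimisers of the auxiliary variables may be moved along with x.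
--
-- (a) By (C1) the value f^m(g(y)) is superharmonic along the chain, so it is constant on the closed
-- component of any g* ∈ 𝔾*: at a point where it is least, all successors have the same value.
--
-- (b) Take λ stationary on a closed component.  Averaging (C2) over λ gives
-- f^λ_i(x) ≤ (1/(m-1)) Σ_{j≠i} f^λ_j(x) for every i, and applying this to the largest f^λ_i(x)
-- forces equality.  Since the weights lie in an arbitrary ordered field, λ is obtained by
-- eliminating states one at a time rather than by a limit.

open import Defs
open import Data.Empty using (⊥-elim)
open import Data.Fin.Base as Fin using (Fin; zero; suc; finToFun; funToFin; punchIn; splitAt)
open import Data.Fin.Properties as Fin using (all?; any?; ¬∀⟶∃¬; finToFun-funToFin; punchIn-punchOut)
open import Data.Fin.Subset using (Subset; ⁅_⁆; _∪_) renaming (_∈_ to _∈ˢ_; _⊂_ to _⊂ˢ_; _⊃_ to _⊃ˢ_)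
open import Data.Fin.Subset.Induction using (Acc; acc; ⊂-wellFounded; ⊃-wellFounded)
open import Data.Fin.Subset.Properties using (_∈?_; x∈⁅x⁆; x∈⁅y⁆⇒x≡y; x∈p∪q⁻; p⊆p∪q; q⊆p∪q)
import Data.Integer.Base as ℤ
import Data.Integer.Properties as ℤ
open import Data.List.Base as List using (List; []; _∷_)
import Data.List.Extrema as Extrema
open import Data.List.Membership.Propositional using (_∈_)
open import Data.List.Membership.Propositional.Properties using (∈-map⁺; ∈-map⁻; ∈-cartesianProductWith⁺; ∈-allFin)
open import Data.List.Properties using (foldr-++)
import Data.List.Relation.Unary.All as ListAll
open import Data.List.Relation.Unary.Any using (here)
open import Data.Maybe.Base as Maybe using ()
open import Data.Maybe.Properties using (just-injective)
open import Data.Nat.Base using (ℕ; zero; suc; _+_; _^_)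
open import Data.Product.Base using (Σ; ∃; ∃-syntax; _×_; _,_; proj₁; proj₂)
open import Data.Rational.Base as ℚ using (ℚ; 0ℚ; 1ℚ)
import Data.Rational.Properties as ℚ
import Data.Rational.Unnormalised.Base as ℚᵘ
import Data.Rational.Unnormalised.Properties as ℚᵘ
open import Data.Sum.Base using (inj₁; inj₂; [_,_]′)
open import Data.Vec.Base as Vec using (Vec; []; _∷_; _++_; lookup; tabulate; transpose; zipWith; removeAt)
open import Data.Vec.Functional as Vector using (Vector)
open import Data.Vec.Properties using (tabulate∘lookup; tabulate-cong; lookup∘tabulate; lookup-map; lookup-⊛; lookup-replicate; lookup-zipWith; lookup-splitAt; map-∘; map-cong)
open import Data.Vec.Relation.Unary.All using (All)
open import Data.Vec.Relation.Unary.All.Properties using (lookup⁺; lookup⁻)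
open import Algebra.Morphism.Structures using (IsRingHomomorphism)
import Algebra.Properties.CommutativeMonoid.Sum as MonoidSum
import Algebra.Properties.Semiring.Sum as SemiringSum
open import Function.Base using (id; _∘_; flip)
open import Level using (_⊔_)
open import Relation.Binary.Bundles using (Poset)
open import Relation.Binary.Construct.Closure.ReflexiveTransitive using (ε; _◅_; _◅◅_)
import Relation.Binary.Construct.Add.Supremum.Equality as Equality⁺
import Relation.Binary.Construct.Add.Supremum.NonStrict as NonStrict⁺
import Relation.Binary.Construct.Add.Supremum.Strict as Strict⁺
open import Relation.Binary.Core using (Rel)
open import Relation.Binary.Definitions using (Total; Transitive)
open import Relation.Binary.PropositionalEquality as ≡ using (_≡_; _≗_; cong; subst)
import Relation.Binary.Reasoning.PartialOrder as PosetReasoning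
open import Relation.Binary.Structures using (IsDecTotalOrder)
open import Relation.Nullary.Construct.Add.Supremum using (_⁺; ⊤⁺; [_])
open import Relation.Nullary.Decidable using (Dec; yes; no; ¬?; _×-dec_; _→-dec_; decidable-stable; map′)
open import Relation.Nullary.Negation using (¬_)

-- Recurrence in finite automata

-- Two obstacles shape the encoding. Maps can be compared only pointwise, so `𝔾` is not literally a
-- finite set: each map gets a code in `Fin codes`, the chain runs on codes, and several indices may
-- name one map. This is harmless because minima and weighted sums are taken over indices. Costs may
-- be infinite, so every inequality travels with a proof that the values in it are finite. That
-- proof comes from (C1): `⊤⁺` absorbs sums, so a finite bound on the expectation makes each
-- operation of the support keep all labelings in the domain, and by induction so does each word.

module Automaton {k N : ℕ} (step : Fin k → Fin N → Fin N) where

  run : List (Fin k) → Fin N → Fin N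
  run w i = List.foldr step i w

  run-++ : ∀ u w i → run (u List.++ w) i ≡ run u (run w i)
  run-++ u w i = foldr-++ step i u w

  Reach : Fin N → Fin N → Set
  Reach i j = ∃[ w ] run w i ≡ j

  Reach-trans : ∀ {i j l} → Reach i j → Reach j l → Reach i l
  Reach-trans {i} (w , ≡.refl) (u , ≡.refl) = u List.++ w , run-++ u w i

  record Closure (i : Fin N) : Set where
    field
      set      : Subset N
      base     : i ∈ˢ set
      sound    : ∀ {j} → j ∈ˢ set → Reach i j
      closed   : ∀ s {j} → j ∈ˢ set → step s j ∈ˢ set

    complete : ∀ w → run w i ∈ˢ set
    complete []      = base
    complete (s ∷ w) = closed s (complete w)

  -- While some `step s j` escapes the set, adding it preserves soundness; a subset of `Fin N` grows
  -- only finitely often, so the process ends at a closed set. Membership in that set then decides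
  -- reachability.
  saturate : ∀ {i} S → Acc _⊃ˢ_ S → i ∈ˢ S → (∀ {j} → j ∈ˢ S → Reach i j) → Closure i
  saturate S (acc rec) i∈S sound
    with any? (λ j → any? (λ s → (j ∈? S) ×-dec ¬? (step s j ∈? S)))
  ... | no ¬escape = record
    { set = S ; base = i∈S ; sound = sound
    ; closed = λ s {j} j∈S → decidable-stable (step s j ∈? S) λ sj∉S → ¬escape (j , s , j∈S , sj∉S) }
  ... | yes (j , s , j∈S , sj∉S) =
    saturate (S ∪ ⁅ step s j ⁆)
      (rec (p⊆p∪q _ , step s j , q⊆p∪q S _ (x∈⁅x⁆ _) , sj∉S))
      (p⊆p∪q _ i∈S)
      (λ l∈ → [ sound
              , (λ l∈⁅sj⁆ → Reach-trans (sound j∈S) (s ∷ [] , ≡.sym (x∈⁅y⁆⇒x≡y _ l∈⁅sj⁆))) ]′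
              (x∈p∪q⁻ S _ l∈))

  closure : ∀ i → Closure i
  closure i = saturate ⁅ i ⁆ (⊃-wellFounded _) (x∈⁅x⁆ i)
    λ j∈⁅i⁆ → [] , ≡.sym (x∈⁅y⁆⇒x≡y _ j∈⁅i⁆)

  reach? : ∀ i j → Dec (Reach i j)
  reach? i j = map′ sound (λ (w , eq) → subst (_∈ˢ set) eq (complete w)) (j ∈? set)
    where open Closure (closure i)

  Recurrent : Fin N → Set
  Recurrent j = ∀ l → Reach j l → Reach l j

  -- Replacing a state by one from which it cannot be reached back shrinks its closure.
  ∃recurrent : ∀ i → ∃[ j ] Reach i j × Recurrent j
  ∃recurrent i = descend i (⊂-wellFounded _)
    where
    descend : ∀ i → Acc _⊂ˢ_ (Closure.set (closure i)) → ∃[ j ] Reach i j × Recurrent j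
    descend i (acc rec) with all? (λ l → reach? i l →-dec reach? l i)
    ... | yes recurrent = i , ([] , ≡.refl) , recurrent
    ... | no ¬recurrent =
      let l , ¬back = ¬∀⟶∃¬ N _ (λ l → reach? i l →-dec reach? l i) ¬recurrent
          i⇝l = decidable-stable (reach? i l) λ ¬i⇝l → ¬back (⊥-elim ∘ ¬i⇝l)
          j , l⇝j , recurrent = descend l (rec (smaller i⇝l (λ l⇝i → ¬back λ _ → l⇝i)))
      in  j , Reach-trans i⇝l l⇝j , recurrent
      where
      smaller : ∀ {l} → Reach i l → ¬ Reach l i →
                Closure.set (closure l) ⊂ˢ Closure.set (closure i)
      smaller {l} i⇝l ¬l⇝i =
        (λ j∈ → let w , eq = Reach-trans i⇝l (Closure.sound (closure l) j∈)
                in  subst (_∈ˢ _) eq (Closure.complete (closure i) w)) ,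
        i , Closure.base (closure i) , ¬l⇝i ∘ Closure.sound (closure l)

-- The orbits and closed components of 𝔾

lookup-ext : ∀ {a} {A : Set a} {n} {u v : Vec A n} → (∀ i → lookup u i ≡ lookup v i) → u ≡ v
lookup-ext {u = u} {v} eq =
  ≡.trans (≡.sym (tabulate∘lookup u)) (≡.trans (tabulate-cong eq) (tabulate∘lookup v))

module OpCode (d m : ℕ) where

  encodeVec : Vec (Fin d) m → Fin (d ^ m)
  encodeVec = funToFin ∘ lookup

  decodeVec : Fin (d ^ m) → Vec (Fin d) m
  decodeVec = tabulate ∘ finToFun

  decode-encodeVec : ∀ v → decodeVec (encodeVec v) ≡ v
  decode-encodeVec v = ≡.trans (tabulate-cong (finToFun-funToFin (lookup v))) (tabulate∘lookup v)

  codes : ℕ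
  codes = (d ^ m) ^ (d ^ m)

  encode : Op d m → Fin codes
  encode g = funToFin (encodeVec ∘ g ∘ decodeVec)

  decode : Fin codes → Op d m
  decode c = decodeVec ∘ finToFun c ∘ encodeVec

  decode-encode : ∀ g → decode (encode g) ≗ g
  decode-encode g v = begin
    decodeVec (finToFun (encode g) (encodeVec v))    ≡⟨ cong decodeVec (finToFun-funToFin (encodeVec ∘ g ∘ decodeVec) (encodeVec v)) ⟩
    decodeVec (encodeVec (g (decodeVec (encodeVec v)))) ≡⟨ decode-encodeVec _ ⟩
    g (decodeVec (encodeVec v))                      ≡⟨ cong g (decode-encodeVec v) ⟩
    g v                                              ∎
    where open ≡.≡-Reasoning

module _ {c ℓ₁ ℓ₂} {K : OrderedField c ℓ₁ ℓ₂} {d m} (ω : Distribution K (Op d m)) where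

  open Distribution ω using (size) renaming (point to 𝟙)

  compose-++ : ∀ u w → compose ω (u List.++ w) ≗ compose ω u ∘ compose ω w
  compose-++ []      w v = ≡.refl
  compose-++ (s ∷ u) w v = cong (𝟙 s) (compose-++ u w v)

  -- Membership in 𝔾* in terms of words instead of paths.
  Returning : Op d m → Set
  Returning g = ∀ w → ∃[ u ] g ≗ compose ω u ∘ compose ω w ∘ g

  𝔾-compose : ∀ {g} w → 𝔾 ω g → 𝔾 ω (compose ω w ∘ g)
  𝔾-compose w (u , eq) =
    w List.++ u , λ v → ≡.trans (cong (compose ω w) (eq v)) (≡.sym (compose-++ w u v))

  word⇒path : ∀ {g h} → 𝔾 ω g → ∀ w → h ≗ compose ω w ∘ g → _⟶*_ ω g h
  word⇒path g∈𝔾 []      eq = inj₁ (≡.sym ∘ eq) ◅ ε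
  word⇒path g∈𝔾 (s ∷ w) eq =
    word⇒path g∈𝔾 w (λ _ → ≡.refl) ◅◅ inj₂ (𝔾-compose w g∈𝔾 , s , eq) ◅ ε

  path⇒word : ∀ {g h} → _⟶*_ ω g h → ∃[ w ] h ≗ compose ω w ∘ g
  path⇒word ε = [] , λ _ → ≡.refl
  path⇒word (inj₁ g≗g′ ◅ path) with path⇒word path
  ... | w , eq = w , λ v → ≡.trans (eq v) (cong (compose ω w) (≡.sym (g≗g′ v)))
  path⇒word (inj₂ (_ , s , g′≗) ◅ path) with path⇒word path
  ... | w , eq = w List.++ (s ∷ []) , λ v →
    ≡.trans (eq v) (≡.trans (cong (compose ω w) (g′≗ v)) (≡.sym (compose-++ w (s ∷ []) _)))

  returning⇒𝔾* : ∀ {g} → 𝔾 ω g → Returning g → 𝔾* ω g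
  returning⇒𝔾* {g} g∈𝔾 back = g∈𝔾 , λ {h} {h′} (g⟶h , _) (h∈𝔾 , s , h′≗) →
    let w , h≗   = path⇒word g⟶h
        h′≗sw v  = ≡.trans (h′≗ v) (cong (𝟙 s) (h≗ v))
        u , g≗   = back (s ∷ w)
        w′ , eq  = 𝔾-compose (s ∷ w) g∈𝔾
    in  word⇒path g∈𝔾 (s ∷ w) h′≗sw ,
        word⇒path (w′ , λ v → ≡.trans (h′≗sw v) (eq v)) u
          (λ v → ≡.trans (g≗ v) (cong (compose ω u) (≡.sym (h′≗sw v))))

  𝔾*⇒returning : ∀ {g} → 𝔾* ω g → Returning g
  𝔾*⇒returning {g} (g∈𝔾 , sink) w = path⇒word (proj₂ (component w))
    where
    -- The sink condition speaks of single edges; applied letter by letter it keeps every word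
    -- inside the component.
    component : ∀ w → StronglyConnected ω g (compose ω w ∘ g)
    component []      = ε , ε
    component (s ∷ w) = sink (component w) (𝔾-compose w g∈𝔾 , s , λ _ → ≡.refl)

  𝔾*-compose : ∀ {g h} → 𝔾* ω g → ∀ w → h ≗ compose ω w ∘ g → 𝔾* ω h
  𝔾*-compose {g} {h} g∈𝔾* w h≗ = returning⇒𝔾*
    (let u , eq = 𝔾-compose w (proj₁ g∈𝔾*) in u , λ v → ≡.trans (h≗ v) (eq v))
    -- To return to `h` after `u`, go back to `g` by the word `u′` that undoes `u List.++ w`, then
    -- replay `w`.
    λ u → let u′ , g≗ = 𝔾*⇒returning g∈𝔾* (u List.++ w) in
      w List.++ u′ , λ v → begin
        h v                                                        ≡⟨ h≗ v ⟩
        compose ω w (g v)                                          ≡⟨ cong (compose ω w) (g≗ v) ⟩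
        compose ω w (compose ω u′ (compose ω (u List.++ w) (g v))) ≡⟨ compose-++ w u′ _ ⟨
        compose ω (w List.++ u′) (compose ω (u List.++ w) (g v))   ≡⟨ cong (compose ω (w List.++ u′)) (compose-++ u w (g v)) ⟩
        compose ω (w List.++ u′) (compose ω u (compose ω w (g v))) ≡⟨ cong (compose ω (w List.++ u′) ∘ compose ω u) (h≗ v) ⟨
        compose ω (w List.++ u′) (compose ω u (h v))               ∎
    where open ≡.≡-Reasoning

  open OpCode d m

  step : Fin size → Fin codes → Fin codes
  step s j = encode (𝟙 s ∘ decode j)

  open Automaton step

  decode-run : ∀ w j → decode (run w j) ≗ compose ω w ∘ decode j
  decode-run []      j v = ≡.refl
  decode-run (s ∷ w) j v = ≡.trans (decode-encode (𝟙 s ∘ decode (run w j)) v) (cong (𝟙 s) (decode-run w j v))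

  -- A finite indexing (with repetitions) of { compose w ∘ g }.
  record Orbit (g : Op d m) : Set where
    field
      count     : ℕ
      elem      : Fin count → Op d m
      next      : Fin size → Fin count → Fin count
      origin    : Fin count
      elem-next : ∀ s j → elem (next s j) ≗ 𝟙 s ∘ elem j
      elem-word : ∀ j → ∃[ w ] elem j ≗ compose ω w ∘ g

    elem-run : ∀ w j → elem (Automaton.run next w j) ≗ compose ω w ∘ elem j
    elem-run []      j v = ≡.refl
    elem-run (s ∷ w) j v = ≡.trans (elem-next s _ v) (cong (𝟙 s) (elem-run w j v))

  orbit : ∀ g → Orbit g
  orbit g = record
    { count = codes
    ; elem = decode ∘ retract
    ; next = λ s → step s ∘ retract
    ; origin = encode g
    ; elem-next = λ s j v →
        ≡.trans (cong (λ l → decode l v) (retract-fixes (closed s (retract∈ j))))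
              (decode-encode (𝟙 s ∘ decode (retract j)) v)
    ; elem-word = λ j → let w , eq = sound (retract∈ j) in
        w , λ v → ≡.trans (cong (λ l → decode l v) (≡.sym eq))
                 (≡.trans (decode-run w _ v) (cong (compose ω w) (decode-encode g v)))
    }
    where
    open Closure (closure (encode g))

    -- Codes outside the orbit are sent to its origin, so that all of `Fin codes` can serve as index
    -- set.
    retract : Fin codes → Fin codes
    retract j with j ∈? set
    ... | yes _ = j
    ... | no  _ = encode g

    retract∈ : ∀ j → retract j ∈ˢ set
    retract∈ j with j ∈? set
    ... | yes j∈ = j∈
    ... | no  _  = base

    retract-fixes : ∀ {j} → j ∈ˢ set → retract j ≡ j
    retract-fixes {j} j∈ with j ∈? set
    ... | yes _  = ≡.refl
    ... | no  j∉ = ⊥-elim (j∉ j∈)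

  -- Started at the code of the identity, the automaton visits only codes of words. A recurrent
  -- state reached from there therefore decodes to a member of `𝔾`, and its recurrence becomes
  -- `Returning`.
  ∃𝔾* : ∃ (𝔾* ω)
  ∃𝔾* with ∃recurrent (encode id)
  ... | j , (w , ≡.refl) , recurrent = decode j , returning⇒𝔾*
    (w , λ v → ≡.trans (decode-run w _ v) (cong (compose ω w) (decode-encode id v)))
    λ u → let u′ , eq = recurrent (run u j) (u , ≡.refl) in
      u′ , λ v → ≡.trans (≡.sym (cong (λ l → decode l v) eq))
                (≡.trans (decode-run u′ _ v) (cong (compose ω u′) (decode-run u j v)))

-- Sums and stationary vectors over an ordered field

-- The relation is left generic to serve both for a minimum over an orbit and, with the order
-- flipped, for the largest expected cost. The argument `Fin n` witnesses that the family is
-- non-empty.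
extremal : ∀ {a ℓ} {A : Set a} {_≲_ : Rel A ℓ} → Total _≲_ → Transitive _≲_ →
           ∀ {n} → Fin n → (u : Vector A n) → ∃[ i ] ∀ j → u i ≲ u j
extremal {_≲_ = _≲_} total ≲-trans {suc n} _ u = go u
  where
  ≲-refl : ∀ {x} → x ≲ x
  ≲-refl {x} = [ id , id ]′ (total x x)

  go : ∀ {n} (u : Vector _ (suc n)) → ∃[ i ] ∀ j → u i ≲ u j
  go {zero}  u = zero , λ { zero → ≲-refl }
  go {suc n} u with go (u ∘ suc)
  ... | i , least with total (u zero) (u (suc i))
  ...   | inj₁ u₀≲uᵢ = zero  , λ { zero → ≲-refl ; (suc j) → ≲-trans u₀≲uᵢ (least j) }
  ...   | inj₂ uᵢ≲u₀ = suc i , λ { zero → uᵢ≲u₀ ; (suc j) → least j }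

module OrderedFieldProperties {c ℓ₁ ℓ₂} (K : OrderedField c ℓ₁ ℓ₂) where

  open OrderedField K hiding (zero)
  open IsDecTotalOrder isDecTotalOrder public
    using (antisym; total; _≟_)
    renaming (refl to ≤-refl; trans to ≤-trans; reflexive to ≤-reflexive)
  open MonoidSum +-commutativeMonoid public using (sum-cong-≋; ∑-distrib-+; ∑-comm)
  open SemiringSum semiring public using (*-distribˡ-sum; *-distribʳ-sum)
  open IsRingHomomorphism ι-homomorphism public
    renaming (⟦⟧-cong to ι-cong) using (+-homo; *-homo; 0#-homo; 1#-homo; -‿homo)

  poset : Poset c ℓ₁ ℓ₂
  poset = record { isPartialOrder = IsDecTotalOrder.isPartialOrder isDecTotalOrder }

  open PosetReasoning poset

  +-mono-≤ : ∀ {x y u v} → x ≤ y → u ≤ v → (x ⊕ u) ≤ (y ⊕ v)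
  +-mono-≤ {x} {y} {u} {v} x≤y u≤v = begin
    x ⊕ u ≤⟨ +-monoˡ-≤ u x≤y ⟩
    y ⊕ u ≈⟨ +-comm y u ⟩
    u ⊕ y ≤⟨ +-monoˡ-≤ y u≤v ⟩
    v ⊕ y ≈⟨ +-comm v y ⟩
    y ⊕ v ∎

  +-cancelʳ-≤ : ∀ {x y} z → (x ⊕ z) ≤ (y ⊕ z) → x ≤ y
  +-cancelʳ-≤ {x} {y} z x+z≤y+z = begin
    x                 ≈⟨ cancel x ⟨
    (x ⊕ z) ⊕ (- z)   ≤⟨ +-monoˡ-≤ (- z) x+z≤y+z ⟩
    (y ⊕ z) ⊕ (- z)   ≈⟨ cancel y ⟩
    y                 ∎
    where
    cancel : ∀ x → ((x ⊕ z) ⊕ (- z)) ≈ x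
    cancel x = trans (+-assoc x z (- z)) (trans (+-congˡ (-‿inverseʳ z)) (+-identityʳ x))

  0≤y-x⇒x≤y : ∀ {x y} → 0# ≤ (y - x) → x ≤ y
  0≤y-x⇒x≤y {x} {y} 0≤y-x = begin
    x              ≈⟨ +-identityˡ x ⟨
    0# ⊕ x         ≤⟨ +-monoˡ-≤ x 0≤y-x ⟩
    (y - x) ⊕ x    ≈⟨ +-assoc y (- x) x ⟩
    y ⊕ ((- x) ⊕ x) ≈⟨ +-congˡ (-‿inverseˡ x) ⟩
    y ⊕ 0#         ≈⟨ +-identityʳ y ⟩
    y              ∎

  x≤y⇒0≤y-x : ∀ {x y} → x ≤ y → 0# ≤ (y - x)
  x≤y⇒0≤y-x {x} {y} x≤y = begin
    0#    ≈⟨ -‿inverseʳ x ⟨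
    x - x ≤⟨ +-monoˡ-≤ (- x) x≤y ⟩
    y - x ∎

  *-monoˡ-≤-nonNeg : ∀ {z x y} → 0# ≤ z → x ≤ y → (z ⊛ x) ≤ (z ⊛ y)
  *-monoˡ-≤-nonNeg {z} {x} {y} 0≤z x≤y = 0≤y-x⇒x≤y (begin
    0#                    ≤⟨ *-nonNeg 0≤z (x≤y⇒0≤y-x x≤y) ⟩
    z ⊛ (y - x)           ≈⟨ distribˡ z y (- x) ⟩
    (z ⊛ y) ⊕ (z ⊛ (- x)) ≈⟨ +-congˡ (-‿distribʳ-* z x) ⟨
    (z ⊛ y) - (z ⊛ x)     ∎)
    where open import Algebra.Properties.Ring ring using (-‿distribʳ-*)

  *-cancelˡ-≉0 : ∀ {z x y} → ¬ z ≈ 0# → (z ⊛ x) ≈ (z ⊛ y) → x ≈ y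
  *-cancelˡ-≉0 {z} {x} {y} z≉0 zx≈zy with invertible z z≉0
  ... | z⁻¹ , zz⁻¹≈1 = trans (sym (cancel x)) (trans (*-congˡ zx≈zy) (cancel y))
    where
    cancel : ∀ x → (z⁻¹ ⊛ (z ⊛ x)) ≈ x
    cancel x = trans (sym (*-assoc z⁻¹ z x))
      (trans (*-congʳ (trans (*-comm z⁻¹ z) zz⁻¹≈1)) (*-identityˡ x))

  0≤1 : 0# ≤ 1#
  0≤1 = begin
    0#   ≈⟨ 0#-homo ⟨
    ι 0ℚ ≤⟨ ι-mono-≤ (ℚ.nonNegative⁻¹ 1ℚ) ⟩
    ι 1ℚ ≈⟨ 1#-homo ⟩
    1#   ∎

  inverse-nonNeg : ∀ {x y} → 0# ≤ x → (x ⊛ y) ≈ 1# → 0# ≤ y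
  inverse-nonNeg {x} {y} 0≤x xy≈1 with total 0# y
  ... | inj₁ 0≤y = 0≤y
  ... | inj₂ y≤0 = ⊥-elim (0≉1 (antisym 0≤1 (begin
    1#     ≈⟨ xy≈1 ⟨
    x ⊛ y  ≤⟨ *-monoˡ-≤-nonNeg 0≤x y≤0 ⟩
    x ⊛ 0# ≈⟨ zeroʳ x ⟩
    0#     ∎)))

  +-nonNeg : ∀ {x y} → 0# ≤ x → 0# ≤ y → 0# ≤ (x ⊕ y)
  +-nonNeg 0≤x 0≤y = ≤-trans (≤-reflexive (sym (+-identityˡ 0#))) (+-mono-≤ 0≤x 0≤y)

  sum-mono-≤ : ∀ {n} {u v : Vector Carrier n} → (∀ i → u i ≤ v i) → sum u ≤ sum v
  sum-mono-≤ {zero}  u≤v = ≤-refl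
  sum-mono-≤ {suc n} u≤v = +-mono-≤ (u≤v zero) (sum-mono-≤ (u≤v ∘ suc))

  sum-zero : ∀ {n} {u : Vector Carrier n} → (∀ i → u i ≈ 0#) → sum u ≈ 0#
  sum-zero {zero}  u≈0 = refl
  sum-zero {suc n} u≈0 = trans (+-cong (u≈0 zero) (sum-zero (u≈0 ∘ suc))) (+-identityˡ 0#)

  sum-nonNeg : ∀ {n} {u : Vector Carrier n} → (∀ i → 0# ≤ u i) → 0# ≤ sum u
  sum-nonNeg {zero}  0≤u = ≤-refl
  sum-nonNeg {suc n} 0≤u = +-nonNeg (0≤u zero) (sum-nonNeg (0≤u ∘ suc))

  -- One strictly smaller term would make the total strictly smaller. The equality arguments below
  -- are all instances: an absorbing state, the minimum principle, and the comparison of the largest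
  -- expected cost with the mean of the others.
  sum-squeeze : ∀ {n} {u v : Vector Carrier n} → (∀ i → u i ≤ v i) → sum v ≤ sum u →
                ∀ i → u i ≈ v i
  sum-squeeze {suc n} {u} {v} u≤v Σv≤Σu zero = antisym (u≤v zero)
    (+-cancelʳ-≤ (sum (u ∘ suc))
      (≤-trans (+-mono-≤ ≤-refl (sum-mono-≤ (u≤v ∘ suc))) Σv≤Σu))
  sum-squeeze {suc n} {u} {v} u≤v Σv≤Σu (suc i) = sum-squeeze (u≤v ∘ suc)
    (+-cancelʳ-≤ (u zero) (begin
      sum (v ∘ suc) ⊕ u zero ≤⟨ +-mono-≤ ≤-refl (u≤v zero) ⟩
      sum (v ∘ suc) ⊕ v zero ≈⟨ +-comm _ _ ⟩
      sum v                  ≤⟨ Σv≤Σu ⟩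
      sum u                  ≈⟨ +-comm _ _ ⟩
      sum (u ∘ suc) ⊕ u zero ∎)) i

  -- A nonzero difference is a unit of ℚ, and a homomorphism that kills a unit forces `0# ≈ 1#`.
  ι-injective : ∀ {p q} → ι p ≈ ι q → p ≡ q
  ι-injective {p} {q} ιp≈ιq with q ℚ.- p ℚ.≟ 0ℚ
  ... | yes q-p≡0 = ≡.sym (x∙y⁻¹≈ε⇒x≈y q p q-p≡0)
    where open import Algebra.Properties.Group ℚ.+-0-group using (x∙y⁻¹≈ε⇒x≈y)
  ... | no  q-p≢0 = ⊥-elim (0≉1 (begin-equality
    0#                             ≈⟨ zeroˡ _ ⟨
    0# ⊛ ι (ℚ.1/ (q ℚ.- p))          ≈⟨ *-congʳ ι[q-p]≈0 ⟨
    ι (q ℚ.- p) ⊛ ι (ℚ.1/ (q ℚ.- p)) ≈⟨ *-homo _ _ ⟨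
    ι ((q ℚ.- p) ℚ.* ℚ.1/ (q ℚ.- p)) ≈⟨ ι-cong (ℚ.*-inverseʳ (q ℚ.- p)) ⟩
    ι 1ℚ                           ≈⟨ 1#-homo ⟩
    1#                             ∎))
    where
    instance _ = ℚ.≢-nonZero q-p≢0
    ι[q-p]≈0 : ι (q ℚ.- p) ≈ 0#
    ι[q-p]≈0 = begin-equality
      ι (q ℚ.- p)        ≈⟨ +-homo q (ℚ.- p) ⟩
      ι q ⊕ ι (ℚ.- p)    ≈⟨ +-congˡ (-‿homo p) ⟩
      ι q - ι p          ≈⟨ +-congʳ ιp≈ιq ⟨
      ι p - ι p          ≈⟨ -‿inverseʳ (ι p) ⟩
      0#                 ∎

  ι-sum : ∀ {n} (u : Vector ℚ n) → ι (Vector.foldr ℚ._+_ 0ℚ u) ≈ sum (ι ∘ u)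
  ι-sum {zero}  u = 0#-homo
  ι-sum {suc n} u = trans (+-homo _ _) (+-congˡ (ι-sum (u ∘ suc)))

  δ : ∀ {n} → Fin n → Vector Carrier n
  δ i j with i Fin.≟ j
  ... | yes _ = 1#
  ... | no  _ = 0#

  0≤δ : ∀ {n} (i j : Fin n) → 0# ≤ δ i j
  0≤δ i j with i Fin.≟ j
  ... | yes _ = 0≤1
  ... | no  _ = ≤-refl

  sum-δ : ∀ {n} (i : Fin n) (u : Vector Carrier n) → sum (λ j → δ i j ⊛ u j) ≈ u i
  sum-δ {suc n} zero    u = trans (+-cong (*-identityˡ _) (sum-zero {n} λ j → zeroˡ _)) (+-identityʳ _)
  sum-δ {suc n} (suc i) u = begin-equality
    (0# ⊛ u zero) ⊕ sum (λ j → δ (suc i) (suc j) ⊛ u (suc j)) ≈⟨ +-cong (zeroˡ _) (sum-cong-≋ {n} λ j → *-congʳ (δ-suc j)) ⟩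
    0# ⊕ sum (λ j → δ i j ⊛ u (suc j))                        ≈⟨ +-identityˡ _ ⟩
    sum (λ j → δ i j ⊛ u (suc j))                             ≈⟨ sum-δ i (u ∘ suc) ⟩
    u (suc i)                                                 ∎
    where
    δ-suc : ∀ j → δ (suc i) (suc j) ≈ δ i j
    δ-suc j with i Fin.≟ j
    ... | yes _ = refl
    ... | no  _ = refl

  -- The bound `1# ≤ sum π` replaces total mass one because it survives the addition of a state with
  -- nonnegative mass. A single normalisation at the end, in `invariant`, then suffices.
  IsStationary : ∀ {n} → (Fin n → Fin n → Carrier) → Vector Carrier n → Set (ℓ₁ ⊔ ℓ₂)
  IsStationary P π = (∀ i → 0# ≤ π i) × 1# ≤ sum π × ∀ j → sum (λ i → π i ⊛ P i j) ≈ π j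

  -- Q is the chain P watched only while it is outside state zero.
  module Censoring {n} (P : Fin (suc n) → Fin (suc n) → Carrier)
    (0≤P : ∀ i j → 0# ≤ P i j) (ΣP≈1 : ∀ i → sum (P i) ≈ 1#)
    (r : Carrier) (Br≈1 : (sum (P zero ∘ suc) ⊛ r) ≈ 1#) where

    B : Carrier
    B = sum (P zero ∘ suc)

    rB≈1 : (r ⊛ B) ≈ 1#
    rB≈1 = trans (*-comm r B) Br≈1

    0≤r : 0# ≤ r
    0≤r = inverse-nonNeg (sum-nonNeg (0≤P zero ∘ suc)) Br≈1

    -- `B` is the probability of leaving state zero in one step, so `r` is 1/(1 - `P zero zero`),
    -- the value of the geometric series over the time spent at zero, and `r ⊛ P zero (suc j)` is
    -- the probability that the exit leads to `suc j`. Taking the inverse directly avoids any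
    -- question of convergence.
    Q : Fin n → Fin n → Carrier
    Q i j = P (suc i) (suc j) ⊕ (P (suc i) zero ⊛ (r ⊛ P zero (suc j)))

    0≤Q : ∀ i j → 0# ≤ Q i j
    0≤Q i j = +-nonNeg (0≤P _ _) (*-nonNeg (0≤P _ _) (*-nonNeg 0≤r (0≤P _ _)))

    ΣQ≈1 : ∀ i → sum (Q i) ≈ 1#
    ΣQ≈1 i = begin-equality
      sum (Q i)                                                  ≈⟨ ∑-distrib-+ (P (suc i) ∘ suc) _ ⟩
      A ⊕ sum (λ j → P (suc i) zero ⊛ (r ⊛ P zero (suc j)))      ≈⟨ +-congˡ (*-distribˡ-sum (P (suc i) zero) (λ j → r ⊛ P zero (suc j))) ⟨
      A ⊕ (P (suc i) zero ⊛ sum (λ j → r ⊛ P zero (suc j)))      ≈⟨ +-congˡ (*-congˡ (*-distribˡ-sum r (P zero ∘ suc))) ⟨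
      A ⊕ (P (suc i) zero ⊛ (r ⊛ B))                             ≈⟨ +-congˡ (*-congˡ rB≈1) ⟩
      A ⊕ (P (suc i) zero ⊛ 1#)                                  ≈⟨ +-congˡ (*-identityʳ _) ⟩
      A ⊕ P (suc i) zero                                         ≈⟨ +-comm _ _ ⟩
      sum (P (suc i))                                            ≈⟨ ΣP≈1 (suc i) ⟩
      1#                                                         ∎
      where A = sum (P (suc i) ∘ suc)

    extend : ∃ (IsStationary Q) → ∃ (IsStationary P)
    extend (π′ , 0≤π′ , 1≤Σπ′ , π′Q≈π′) = π , 0≤π , 1≤Σπ , πP≈π
      where
      T = sum (λ i → π′ i ⊛ P (suc i) zero)

      -- Balance at state zero reads `π zero ⊛ B ≈ T`, where `T` is the inflow from the other
      -- states; this forces the value `T ⊛ r`.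
      π : Vector Carrier (suc n)
      π zero    = T ⊛ r
      π (suc i) = π′ i

      0≤π : ∀ i → 0# ≤ π i
      0≤π zero    = *-nonNeg (sum-nonNeg (λ i → *-nonNeg (0≤π′ i) (0≤P _ _))) 0≤r
      0≤π (suc i) = 0≤π′ i

      1≤Σπ : 1# ≤ sum π
      1≤Σπ = ≤-trans (≤-reflexive (sym (+-identityˡ 1#))) (+-mono-≤ (0≤π zero) 1≤Σπ′)

      πP≈π : ∀ j → sum (λ i → π i ⊛ P i j) ≈ π j
      πP≈π zero = begin-equality
        ((T ⊛ r) ⊛ P zero zero) ⊕ T              ≈⟨ +-congˡ (*-identityʳ T) ⟨
        ((T ⊛ r) ⊛ P zero zero) ⊕ (T ⊛ 1#)       ≈⟨ +-congˡ (*-congˡ rB≈1) ⟨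
        ((T ⊛ r) ⊛ P zero zero) ⊕ (T ⊛ (r ⊛ B))  ≈⟨ +-congˡ (*-assoc T r B) ⟨
        ((T ⊛ r) ⊛ P zero zero) ⊕ ((T ⊛ r) ⊛ B)  ≈⟨ distribˡ (T ⊛ r) _ _ ⟨
        (T ⊛ r) ⊛ sum (P zero)                   ≈⟨ *-congˡ (ΣP≈1 zero) ⟩
        (T ⊛ r) ⊛ 1#                             ≈⟨ *-identityʳ _ ⟩
        T ⊛ r                                    ∎
      πP≈π (suc j) = begin-equality
        ((T ⊛ r) ⊛ P zero (suc j)) ⊕ sum (λ i → π′ i ⊛ P (suc i) (suc j))
          ≈⟨ +-comm _ _ ⟩
        sum (λ i → π′ i ⊛ P (suc i) (suc j)) ⊕ ((T ⊛ r) ⊛ P zero (suc j))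
          ≈⟨ +-congˡ (*-assoc T r _) ⟩
        sum (λ i → π′ i ⊛ P (suc i) (suc j)) ⊕ (T ⊛ (r ⊛ P zero (suc j)))
          ≈⟨ +-congˡ (*-distribʳ-sum (r ⊛ P zero (suc j)) (λ i → π′ i ⊛ P (suc i) zero)) ⟩
        sum (λ i → π′ i ⊛ P (suc i) (suc j)) ⊕
        sum (λ i → (π′ i ⊛ P (suc i) zero) ⊛ (r ⊛ P zero (suc j)))
          ≈⟨ ∑-distrib-+ (λ i → π′ i ⊛ P (suc i) (suc j)) _ ⟨
        sum (λ i → (π′ i ⊛ P (suc i) (suc j)) ⊕ ((π′ i ⊛ P (suc i) zero) ⊛ (r ⊛ P zero (suc j))))
          ≈⟨ sum-cong-≋ {n} (λ i → trans (+-congˡ (*-assoc _ _ _)) (sym (distribˡ _ _ _))) ⟩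
        sum (λ i → π′ i ⊛ Q i j)
          ≈⟨ π′Q≈π′ j ⟩
        π′ j ∎

  -- If the probability of leaving state zero vanishes, that state is absorbing and its point mass
  -- is stationary. Otherwise this probability is invertible and the chain can be censored to one
  -- state fewer.
  ∃stationary : ∀ {n} → Fin n → (P : Fin n → Fin n → Carrier) →
    (∀ i j → 0# ≤ P i j) → (∀ i → sum (P i) ≈ 1#) → ∃ (IsStationary P)
  ∃stationary {suc n} _ P 0≤P ΣP≈1 with sum (P zero ∘ suc) ≟ 0#
  ... | yes B≈0 =
    δ zero , 0≤δ zero ,
    ≤-reflexive (trans (sym (sum-δ {suc n} zero (λ _ → 1#))) (sum-cong-≋ {suc n} {λ j → δ zero j ⊛ 1#} {δ zero} λ j → *-identityʳ _)) ,
    λ j → trans (sum-δ zero (λ i → P i j)) (P₀≈δ j)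
    where
    P₀≈δ : ∀ j → P zero j ≈ δ zero j
    P₀≈δ zero    = begin-equality
      P zero zero      ≈⟨ +-identityʳ _ ⟨
      P zero zero ⊕ 0# ≈⟨ +-congˡ B≈0 ⟨
      sum (P zero)     ≈⟨ ΣP≈1 zero ⟩
      1#               ∎
    P₀≈δ (suc j) = sym (sum-squeeze (0≤P zero ∘ suc)
      (≤-reflexive (trans B≈0 (sym (sum-zero {n} λ _ → refl)))) j)
  -- With a single state the probability of leaving it is the empty sum.
  ∃stationary {suc zero}    _ P 0≤P ΣP≈1 | no B≉0 = ⊥-elim (B≉0 refl)
  ∃stationary {suc (suc n)} _ P 0≤P ΣP≈1 | no B≉0 =
    let r , Br≈1 = invertible _ B≉0
        open Censoring P 0≤P ΣP≈1 r Br≈1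
    in  extend (∃stationary zero Q 0≤Q ΣQ≈1)

  -- Associativity of the product of a row vector, a matrix and a column vector: it moves a
  -- transition from measures to functions.
  sum-*-assoc : ∀ {k n} (a : Vector Carrier k) (M : Fin k → Fin n → Carrier) (φ : Vector Carrier n) →
    sum (λ j → sum (λ s → a s ⊛ M s j) ⊛ φ j) ≈ sum (λ s → a s ⊛ sum (λ j → M s j ⊛ φ j))
  sum-*-assoc {k} {n} a M φ = begin-equality
    sum (λ j → sum (λ s → a s ⊛ M s j) ⊛ φ j)   ≈⟨ sum-cong-≋ {n} (λ j → *-distribʳ-sum (φ j) (λ s → a s ⊛ M s j)) ⟩
    sum (λ j → sum (λ s → (a s ⊛ M s j) ⊛ φ j)) ≈⟨ ∑-comm {n} {k} (λ j s → (a s ⊛ M s j) ⊛ φ j) ⟩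
    sum (λ s → sum (λ j → (a s ⊛ M s j) ⊛ φ j)) ≈⟨ sum-cong-≋ {k} (λ s → sum-cong-≋ {n} (λ j → *-assoc (a s) (M s j) (φ j))) ⟩
    sum (λ s → sum (λ j → a s ⊛ (M s j ⊛ φ j))) ≈⟨ sum-cong-≋ {k} (λ s → *-distribˡ-sum (a s) (λ j → M s j ⊛ φ j)) ⟨
    sum (λ s → a s ⊛ sum (λ j → M s j ⊛ φ j))   ∎

  module RandomMap {k n} (w : Vector Carrier k) (0≤w : ∀ s → 0# ≤ w s) (Σw≈1 : sum w ≈ 1#)
    (next : Fin k → Fin n → Fin n) where

    P : Fin n → Fin n → Carrier
    P i j = sum (λ s → w s ⊛ δ (next s i) j)

    P-expectation : ∀ φ i → sum (λ j → P i j ⊛ φ j) ≈ sum (λ s → w s ⊛ φ (next s i))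
    P-expectation φ i = trans (sum-*-assoc w (λ s → δ (next s i)) φ)
      (sum-cong-≋ {k} λ s → *-congˡ (sum-δ (next s i) φ))

    ΣP≈1 : ∀ i → sum (P i) ≈ 1#
    ΣP≈1 i = begin-equality
      sum (P i)              ≈⟨ sum-cong-≋ {n} (λ j → *-identityʳ (P i j)) ⟨
      sum (λ j → P i j ⊛ 1#) ≈⟨ P-expectation (λ _ → 1#) i ⟩
      sum (λ s → w s ⊛ 1#)   ≈⟨ sum-cong-≋ {k} (λ s → *-identityʳ (w s)) ⟩
      sum w                  ≈⟨ Σw≈1 ⟩
      1#                     ∎

    -- Stationarity is stated against test functions `φ`, since costs will be substituted for `φ`.
    -- The factor `t` normalises; it exists because the total mass is at least `1#`.
    invariant : Fin n → Σ (Vector Carrier n) λ π → (∀ i → 0# ≤ π i) × sum π ≈ 1# ×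
      (∀ (φ : Vector Carrier n) → sum (λ i → π i ⊛ sum (λ s → w s ⊛ φ (next s i))) ≈ sum (λ i → π i ⊛ φ i))
    invariant i₀
      with π , 0≤π , 1≤Σπ , πP≈π ← ∃stationary i₀ P (λ i j → sum-nonNeg λ s → *-nonNeg (0≤w s) (0≤δ (next s i) j)) ΣP≈1
      with t , Σπt≈1 ← invertible (sum π) (λ Σπ≈0 → 0≉1 (antisym 0≤1 (≤-trans 1≤Σπ (≤-reflexive Σπ≈0))))
      = (λ i → π i ⊛ t) ,
        (λ i → *-nonNeg (0≤π i) (inverse-nonNeg (≤-trans 0≤1 1≤Σπ) Σπt≈1)) ,
        trans (sym (*-distribʳ-sum t π)) Σπt≈1 ,
        λ (φ : Vector Carrier n) → begin-equality
          sum (λ i → (π i ⊛ t) ⊛ sum (λ s → w s ⊛ φ (next s i))) ≈⟨ sum-cong-≋ {n} (λ i → *-congˡ (P-expectation φ i)) ⟨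
          sum (λ i → (π i ⊛ t) ⊛ sum (λ j → P i j ⊛ φ j))        ≈⟨ sum-*-assoc (λ i → π i ⊛ t) P φ ⟨
          sum (λ j → sum (λ i → (π i ⊛ t) ⊛ P i j) ⊛ φ j)        ≈⟨ sum-cong-≋ {n} (λ j → *-congʳ (begin-equality
            sum (λ i → (π i ⊛ t) ⊛ P i j) ≈⟨ sum-cong-≋ {n} (λ i → xy∙z≈xz∙y (π i) t (P i j)) ⟩
            sum (λ i → (π i ⊛ P i j) ⊛ t) ≈⟨ *-distribʳ-sum t (λ i → π i ⊛ P i j) ⟨
            sum (λ i → π i ⊛ P i j) ⊛ t   ≈⟨ *-congʳ (πP≈π j) ⟩
            π j ⊛ t                       ∎)) ⟩
          sum (λ j → (π j ⊛ t) ⊛ φ j)                            ∎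
      where open import Algebra.Properties.CommutativeSemigroup *-commutativeSemigroup using (xy∙z≈xz∙y)

-- Labelings

column : ∀ {d m n} → Fin n → Vec (Labeling d n) m → Vec (Fin d) m
column v = Vec.map (λ r → lookup r v)

lookup-transpose : ∀ {d m n} (x : Vec (Labeling d n) m) v → lookup (transpose x) v ≡ column v x
lookup-transpose []       v = lookup-replicate v []
lookup-transpose {d} {suc m} {n} (r ∷ x) v = begin
  lookup (Vec.replicate n cons Vec.⊛ r Vec.⊛ transpose x) v             ≡⟨ lookup-⊛ v (Vec.replicate n cons Vec.⊛ r) (transpose x) ⟩
  lookup (Vec.replicate n cons Vec.⊛ r) v (lookup (transpose x) v)      ≡⟨ cong (λ h → h (lookup (transpose x) v)) (lookup-⊛ v (Vec.replicate n cons) r) ⟩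
  lookup (Vec.replicate n cons) v (lookup r v) (lookup (transpose x) v) ≡⟨ cong (λ h → h (lookup r v) (lookup (transpose x) v)) (lookup-replicate v cons) ⟩
  lookup r v ∷ lookup (transpose x) v                                   ≡⟨ cong (lookup r v ∷_) (lookup-transpose x v) ⟩
  column v (r ∷ x)                                                      ∎
  where
  open ≡.≡-Reasoning
  cons : Fin d → Vec (Fin d) m → Vec (Fin d) (suc m)
  cons = _∷_

lookup-⟨⟩ₙ : ∀ {d m n} (g : Op d m) (x : Vec (Labeling d n) m) i v →
             lookup (lookup (g ⟨ x ⟩ₙ) i) v ≡ lookup (g (column v x)) i
lookup-⟨⟩ₙ g x i v = begin
  lookup (lookup (transpose (Vec.map g (transpose x))) i) v ≡⟨ cong (λ r → lookup r v) (lookup-transpose (Vec.map g (transpose x)) i) ⟩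
  lookup (column i (Vec.map g (transpose x))) v             ≡⟨ lookup-map v _ (Vec.map g (transpose x)) ⟩
  lookup (lookup (Vec.map g (transpose x)) v) i             ≡⟨ cong (λ r → lookup r i) (lookup-map v g (transpose x)) ⟩
  lookup (g (lookup (transpose x) v)) i                     ≡⟨ cong (λ r → lookup (g r) i) (lookup-transpose x v) ⟩
  lookup (g (column v x)) i                                 ∎
  where open ≡.≡-Reasoning

column-⟨⟩ₙ : ∀ {d m n} (g : Op d m) (x : Vec (Labeling d n) m) v →
             column v (g ⟨ x ⟩ₙ) ≡ g (column v x)
column-⟨⟩ₙ g x v = lookup-ext λ i → ≡.trans (lookup-map i _ (g ⟨ x ⟩ₙ)) (lookup-⟨⟩ₙ g x i v)

-- An operation acts on columns by plain application, so identities between tuples of labelings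
-- reduce to identities in D^m, one for each variable, and transposition disappears from the later
-- arguments.
⟨⟩ₙ-ext : ∀ {d m n} (g : Op d m) (x : Vec (Labeling d n) m) {y : Vec (Labeling d n) m} →
          (∀ v → column v y ≡ g (column v x)) → y ≡ g ⟨ x ⟩ₙ
⟨⟩ₙ-ext g x {y} eq = lookup-ext λ i → lookup-ext λ v → begin
  lookup (lookup y i) v         ≡⟨ lookup-map i _ y ⟨
  lookup (column v y) i         ≡⟨ cong (λ r → lookup r i) (eq v) ⟩
  lookup (g (column v x)) i     ≡⟨ lookup-⟨⟩ₙ g x i v ⟨
  lookup (lookup (g ⟨ x ⟩ₙ) i) v ∎
  where open ≡.≡-Reasoning

⟨⟩ₙ-id : ∀ {d m n} (x : Vec (Labeling d n) m) → x ≡ id ⟨ x ⟩ₙ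
⟨⟩ₙ-id x = ⟨⟩ₙ-ext id x λ v → ≡.refl

⟨⟩ₙ-∘ : ∀ {d m n} (g : Op d m) {h k : Op d m} → k ≗ g ∘ h → (x : Vec (Labeling d n) m) →
        g ⟨ h ⟨ x ⟩ₙ ⟩ₙ ≡ k ⟨ x ⟩ₙ
⟨⟩ₙ-∘ g {h} {k} k≗ x = ⟨⟩ₙ-ext k x λ v → begin
  column v (g ⟨ h ⟨ x ⟩ₙ ⟩ₙ) ≡⟨ column-⟨⟩ₙ g (h ⟨ x ⟩ₙ) v ⟩
  g (column v (h ⟨ x ⟩ₙ))    ≡⟨ cong g (column-⟨⟩ₙ h x v) ⟩
  g (h (column v x))         ≡⟨ k≗ (column v x) ⟨
  k (column v x)             ∎
  where open ≡.≡-Reasoning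

-- Operations treat each variable separately, so they commute with reading off the variables of a
-- scope. This is what lets the hypothesis on a cost function be applied to a constraint built from
-- it.
⟨⟩ₙ-map : ∀ {d m n k} (g : Op d m) (z : Vec (Labeling d n) m) (scope : Vec (Fin n) k) i →
  lookup (g ⟨ Vec.map (λ r → Vec.map (lookup r) scope) z ⟩ₙ) i ≡
  Vec.map (lookup (lookup (g ⟨ z ⟩ₙ) i)) scope
⟨⟩ₙ-map g z scope i = lookup-ext λ a → begin
  lookup (lookup (g ⟨ z∣ ⟩ₙ) i) a                        ≡⟨ lookup-⟨⟩ₙ g z∣ i a ⟩
  lookup (g (column a z∣)) i                             ≡⟨ cong (λ r → lookup (g r) i) (column-map a) ⟩
  lookup (g (column (lookup scope a) z)) i               ≡⟨ lookup-⟨⟩ₙ g z i (lookup scope a) ⟨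
  lookup (lookup (g ⟨ z ⟩ₙ) i) (lookup scope a)          ≡⟨ lookup-map a _ scope ⟨
  lookup (Vec.map (lookup (lookup (g ⟨ z ⟩ₙ) i)) scope) a ∎
  where
  open ≡.≡-Reasoning
  z∣ = Vec.map (λ r → Vec.map (lookup r) scope) z
  column-map : ∀ a → column a z∣ ≡ column (lookup scope a) z
  column-map a = ≡.trans (≡.sym (map-∘ _ _ z)) (map-cong (λ r → lookup-map a (lookup r) scope) z)

column-++ : ∀ {d m k l} (x : Vec (Labeling d k) m) (y : Vec (Labeling d l) m) v →
  column v (zipWith _++_ x y) ≡ [ (λ a → column a x) , (λ a → column a y) ]′ (splitAt k v)
column-++ {k = k} x y v = lookup-ext λ i → begin
  lookup (column v (zipWith _++_ x y)) i                              ≡⟨ lookup-map i _ (zipWith _++_ x y) ⟩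
  lookup (lookup (zipWith _++_ x y) i) v                              ≡⟨ cong (λ r → lookup r v) (lookup-zipWith _++_ i x y) ⟩
  lookup (lookup x i ++ lookup y i) v                                 ≡⟨ lookup-splitAt k (lookup x i) (lookup y i) v ⟩
  [ lookup (lookup x i) , lookup (lookup y i) ]′ (splitAt k v)        ≡⟨ pick i (splitAt k v) ⟩
  lookup ([ (λ a → column a x) , (λ a → column a y) ]′ (splitAt k v)) i ∎
  where
  open ≡.≡-Reasoning
  pick : ∀ i s → [ lookup (lookup x i) , lookup (lookup y i) ]′ s ≡
                 lookup ([ (λ a → column a x) , (λ a → column a y) ]′ s) i
  pick i (inj₁ a) = ≡.sym (lookup-map i _ x)
  pick i (inj₂ a) = ≡.sym (lookup-map i _ y)

⟨⟩ₙ-++ : ∀ {d m k l} (g : Op d m) (x : Vec (Labeling d k) m) (y : Vec (Labeling d l) m) →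
         zipWith _++_ (g ⟨ x ⟩ₙ) (g ⟨ y ⟩ₙ) ≡ g ⟨ zipWith _++_ x y ⟩ₙ
⟨⟩ₙ-++ {k = k} g x y = ⟨⟩ₙ-ext g (zipWith _++_ x y) λ v → begin
  column v (zipWith _++_ (g ⟨ x ⟩ₙ) (g ⟨ y ⟩ₙ))                                        ≡⟨ column-++ (g ⟨ x ⟩ₙ) (g ⟨ y ⟩ₙ) v ⟩
  [ (λ a → column a (g ⟨ x ⟩ₙ)) , (λ a → column a (g ⟨ y ⟩ₙ)) ]′ (splitAt k v)         ≡⟨ apply (splitAt k v) ⟩
  g ([ (λ a → column a x) , (λ a → column a y) ]′ (splitAt k v))                       ≡⟨ cong g (column-++ x y v) ⟨
  g (column v (zipWith _++_ x y))                                                      ∎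
  where
  open ≡.≡-Reasoning
  apply : ∀ s → [ (λ a → column a (g ⟨ x ⟩ₙ)) , (λ a → column a (g ⟨ y ⟩ₙ)) ]′ s ≡
                g ([ (λ a → column a x) , (λ a → column a y) ]′ s)
  apply (inj₁ a) = column-⟨⟩ₙ g x a
  apply (inj₂ a) = column-⟨⟩ₙ g y a

lookup-removeAt : ∀ {a} {A : Set a} {n} (xs : Vec A (suc n)) i j →
                  lookup (removeAt xs i) j ≡ lookup xs (punchIn i j)
lookup-removeAt (x ∷ xs)         zero    j       = ≡.refl
lookup-removeAt (x ∷ xs@(_ ∷ _)) (suc i) zero    = ≡.refl
lookup-removeAt (x ∷ xs@(_ ∷ _)) (suc i) (suc j) = lookup-removeAt xs i j

-- Costs and expectations

module _ {a} {A : Set a} (_∙_ : A → A → A) (ε : A) where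

  sum⁺-finite : ∀ {n} {φ : Vector (A ⁺) n} {v} → (∀ i → φ i ≡ [ v i ]) →
                sum⁺ _∙_ ε φ ≡ [ Vector.foldr _∙_ ε v ]
  sum⁺-finite {zero}  eq = ≡.refl
  sum⁺-finite {suc n} eq = ≡.cong₂ (Maybe.zipWith _∙_) (eq zero) (sum⁺-finite (eq ∘ suc))

  -- Since `⊤⁺` is absorbing, one infinite term would make the sum infinite. Membership in the
  -- domain is recovered from cost inequalities in this way.
  sum⁺-finite⁻¹ : ∀ {n} {φ : Vector (A ⁺) n} {q} → sum⁺ _∙_ ε φ ≡ [ q ] →
                  Σ (Vector A n) λ v → (∀ i → φ i ≡ [ v i ]) × q ≡ Vector.foldr _∙_ ε v
  sum⁺-finite⁻¹ {zero}          ≡.refl = (λ ()) , (λ ()) , ≡.refl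
  sum⁺-finite⁻¹ {suc n} {φ = φ} eq
    with [ v₀ ] ← φ zero in eq₀ | [ q ] ← sum⁺ _∙_ ε (φ ∘ suc) in eqₛ
    with ≡.refl ← eq
    with v , eqᵥ , q≡ ← sum⁺-finite⁻¹ eqₛ
    = (λ { zero → v₀ ; (suc i) → v i }) , (λ { zero → eq₀ ; (suc i) → eqᵥ i }) , cong (v₀ ∙_) q≡

map-finite⁻¹ : ∀ {a b} {A : Set a} {B : Set b} (h : A → B) {r : A ⁺} {q} →
               Maybe.map h r ≡ [ q ] → ∃[ p ] r ≡ [ p ] × q ≡ h p
map-finite⁻¹ h {[ p ]} ≡.refl = p , ≡.refl , ≡.refl

sumℚ : ∀ {n} → Vector ℚ n → ℚ
sumℚ = Vector.foldr ℚ._+_ 0ℚ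

sumℚ-1/ : ∀ n → sumℚ {suc n} (λ _ → ℤ.+ 1 ℚ./ suc n) ≡ 1ℚ
sumℚ-1/ n = ≡.trans (partial (suc n)) (ℚ.fromℚᵘ-cong {ℚᵘ.mkℚᵘ (ℤ.+ suc n) n} {ℚᵘ.mkℚᵘ (ℤ.+ 1) 0} (ℚᵘ.*≡* (ℤ.*-comm (ℤ.+ suc n) (ℤ.+ 1))))
  where
  -- Fixing the denominator and varying the number of terms gives an induction; in unnormalised
  -- rationals each step is an integer identity.
  partial : ∀ k → sumℚ {k} (λ _ → ℤ.+ 1 ℚ./ suc n) ≡ ℤ.+ k ℚ./ suc n
  partial zero    = ≡.sym (ℚ.0/n≡0 (suc n))
  partial (suc k) = ℚ.toℚᵘ-injective (begin-equality
    ℚ.toℚᵘ ((ℤ.+ 1 ℚ./ suc n) ℚ.+ sumℚ {k} (λ _ → ℤ.+ 1 ℚ./ suc n)) ≡⟨ cong (λ q → ℚ.toℚᵘ ((ℤ.+ 1 ℚ./ suc n) ℚ.+ q)) (partial k) ⟩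
    ℚ.toℚᵘ ((ℤ.+ 1 ℚ./ suc n) ℚ.+ (ℤ.+ k ℚ./ suc n))                ≃⟨ ℚ.toℚᵘ-homo-+ (ℤ.+ 1 ℚ./ suc n) (ℤ.+ k ℚ./ suc n) ⟩
    ℚ.toℚᵘ (ℤ.+ 1 ℚ./ suc n) ℚᵘ.+ ℚ.toℚᵘ (ℤ.+ k ℚ./ suc n)          ≃⟨ ℚᵘ.+-cong (ℚ.toℚᵘ-fromℚᵘ (ℚᵘ.mkℚᵘ (ℤ.+ 1) n)) (ℚ.toℚᵘ-fromℚᵘ (ℚᵘ.mkℚᵘ (ℤ.+ k) n)) ⟩
    ℚᵘ.mkℚᵘ (ℤ.+ 1) n ℚᵘ.+ ℚᵘ.mkℚᵘ (ℤ.+ k) n                        ≃⟨ ℚᵘ.*≡* common-denominator ⟩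
    ℚᵘ.mkℚᵘ (ℤ.+ suc k) n                                           ≃⟨ ℚ.toℚᵘ-fromℚᵘ (ℚᵘ.mkℚᵘ (ℤ.+ suc k) n) ⟨
    ℚ.toℚᵘ (ℤ.+ suc k ℚ./ suc n)                                    ∎)
    where
    open ℚᵘ.≤-Reasoning
    N = ℤ.+ suc n
    common-denominator : (ℤ.+ 1 ℤ.* N ℤ.+ ℤ.+ k ℤ.* N) ℤ.* N ≡ ℤ.+ suc k ℤ.* (N ℤ.* N)
    common-denominator = ≡.trans (cong (ℤ._* N) (≡.sym (ℤ.*-distribʳ-+ N (ℤ.+ 1) (ℤ.+ k))))
                                 (ℤ.*-assoc (ℤ.+ suc k) N N)

Values : ∀ {d n} → CostFn d n → ∀ {m} → Vec (Labeling d n) m → Vector ℚ m → Set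
Values f x b = ∀ i → f (lookup x i) ≡ [ b i ]

-- Additivity carries a cost inequality over a sum of constraints, and monotonicity carries it over
-- the minimum on the auxiliary variables.
record MonotoneAdditive {m} (L : Vector ℚ m → ℚ) : Set where
  field
    L-0    : L (λ _ → 0ℚ) ≡ 0ℚ
    L-+    : ∀ u v → L (λ i → u i ℚ.+ v i) ≡ L u ℚ.+ L v
    L-mono : ∀ {u v} → (∀ i → u i ℚ.≤ v i) → L u ℚ.≤ L v

  L-cong : ∀ {u v} → u ≗ v → L u ≡ L v
  L-cong u≗v = ℚ.≤-antisym (L-mono (ℚ.≤-reflexive ∘ u≗v)) (L-mono (ℚ.≤-reflexive ∘ ≡.sym ∘ u≗v))

  L-sum : ∀ {n} (u : Fin n → Vector ℚ m) → L (λ i → sumℚ (λ t → u t i)) ≡ sumℚ (L ∘ u)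
  L-sum {zero}  u = L-0
  L-sum {suc n} u = ≡.trans (L-+ (u zero) _) (cong (L (u zero) ℚ.+_) (L-sum (u ∘ suc)))

module ℚₒ = OrderedFieldProperties ℚ-orderedField

mean : ∀ {k m} → (Fin (suc k) → Fin m) → Vector ℚ m → ℚ
mean {k} σ u = (ℤ.+ 1 ℚ./ suc k) ℚ.* sumℚ (u ∘ σ)

mean-monotoneAdditive : ∀ {k m} (σ : Fin (suc k) → Fin m) → MonotoneAdditive (mean σ)
mean-monotoneAdditive {k} σ = record
  { L-0    = ≡.trans (cong (1/k ℚ.*_) (ℚₒ.sum-zero {suc k} {λ _ → 0ℚ} λ _ → ≡.refl)) (ℚ.*-zeroʳ 1/k)
  ; L-+    = λ u v → ≡.trans (cong (1/k ℚ.*_) (ℚₒ.∑-distrib-+ (u ∘ σ) (v ∘ σ)))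
                             (ℚ.*-distribˡ-+ 1/k (sumℚ (u ∘ σ)) (sumℚ (v ∘ σ)))
  ; L-mono = λ {u} {v} u≤v → ℚₒ.*-monoˡ-≤-nonNeg {1/k} 0≤1/k
                               (ℚₒ.sum-mono-≤ {suc k} {u ∘ σ} {v ∘ σ} (u≤v ∘ σ))
  }
  where
  1/k = ℤ.+ 1 ℚ./ suc k
  0≤1/k : 0ℚ ℚ.≤ 1/k
  0≤1/k = ℚ.nonNegative⁻¹ 1/k ⦃ ℚ.normalize-nonNeg 1 (suc k) ⦄

eval-monotoneAdditive : ∀ {m} (i : Fin m) → MonotoneAdditive (λ u → u i)
eval-monotoneAdditive i = record { L-0 = ≡.refl ; L-+ = λ _ _ → ≡.refl ; L-mono = λ u≤v → u≤v i }

avg-finite : ∀ {d n k m} (f : CostFn d n) (x : Vec (Labeling d n) m) {b : Vector ℚ m} → Values f x b →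
  (y : Vec (Labeling d n) (suc k)) (σ : Fin (suc k) → Fin m) → (∀ j → lookup y j ≡ lookup x (σ j)) →
  avg f y ≡ [ mean σ b ]
avg-finite {k = k} f x fx≡b y σ y≡xσ =
  cong (Maybe.map ((ℤ.+ 1 ℚ./ suc k) ℚ.*_)) (sum⁺-finite ℚ._+_ 0ℚ λ j → ≡.trans (cong f (y≡xσ j)) (fx≡b (σ j)))

avg-finite⁻¹ : ∀ {d n k} (f : CostFn d n) (x : Vec (Labeling d n) (suc k)) {q} → avg f x ≡ [ q ] →
  Σ (Vector ℚ (suc k)) λ b → Values f x b × q ≡ mean id b
avg-finite⁻¹ {k = k} f x avg≡q =
  let p , sum≡p , q≡ = map-finite⁻¹ ((ℤ.+ 1 ℚ./ suc k) ℚ.*_) avg≡q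
      b , fx≡b , p≡  = sum⁺-finite⁻¹ ℚ._+_ 0ℚ sum≡p
  in  b , fx≡b , ≡.trans q≡ (cong ((ℤ.+ 1 ℚ./ suc k) ℚ.*_) p≡)

Dom⇒finite : ∀ {d n} {f : CostFn d n} {x} → Dom f x → ∃[ q ] f x ≡ [ q ]
Dom⇒finite {f = f} {x} fx<⊤ with f x | fx<⊤
... | [ q ] | _ = q , ≡.refl

Dom⇒values : ∀ {d n m} (f : CostFn d n) {x : Vec (Labeling d n) m} → All (Dom f) x → ∃ (Values f x)
Dom⇒values f x∈dom = (λ i → proj₁ (finite i)) , λ i → proj₂ (finite i)
  where finite = λ i → Dom⇒finite {f = f} (lookup⁺ x∈dom i)

finite⇒Dom : ∀ {d n} {f : CostFn d n} {x q} → f x ≡ [ q ] → Dom f x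
finite⇒Dom fx≡q = subst (_<⁺ ⊤⁺) (≡.sym fx≡q) Strict⁺.[ _ ]<⊤⁺

-- Minimisation over the auxiliary variables

∈-labelings : ∀ {d n} (y : Labeling d n) → y ∈ labelings d n
∈-labelings []      = here ≡.refl
∈-labelings (a ∷ y) = ∈-cartesianProductWith⁺ _∷_ (∈-allFin a) (∈-labelings y)

open NonStrict⁺ ℚ._≤_ using () renaming (_≤⁺_ to _≤ℚ⁺_)

module _ {d k l} (f : CostFn d k) (h : CostFn d (k + l)) where

  completions : Labeling d k → List (ℚ ⁺)
  completions x = List.map (λ y → h (x ++ y)) (labelings d l)

  min : Labeling d k → ℚ ⁺
  min x = Extrema.min ℚ⁺-totalOrder ⊤⁺ (completions x)

  module _ (f≡min : ∀ x → f x ≡ min x) where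

    min-attained : ∀ {x q} → f x ≡ [ q ] → ∃[ y ] h (x ++ y) ≡ [ q ]
    min-attained {x} {q} fx≡q
      with Extrema.argmin-sel ℚ⁺-totalOrder id ⊤⁺ (completions x)
    -- The minimum is taken with default value `⊤⁺`; a finite result excludes the default, so some
    -- completion attains it.
    ... | inj₁ min≡⊤ with () ← ≡.trans (≡.sym fx≡q) (≡.trans (f≡min x) min≡⊤)
    ... | inj₂ min∈ with ∈-map⁻ _ min∈
    ...   | y , _ , min≡hxy = y , ≡.trans (≡.sym min≡hxy) (≡.trans (≡.sym (f≡min x)) fx≡q)

    min-below : ∀ {x y q} → h (x ++ y) ≡ [ q ] → ∃[ p ] f x ≡ [ p ] × p ℚ.≤ q
    min-below {x} {y} {q} hxy≡q
      with f x | subst (_≤ℚ⁺ [ q ]) (≡.sym (f≡min x)) (subst (min x ≤ℚ⁺_) hxy≡q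
             (ListAll.lookup {P = min x ≤ℚ⁺_} (Extrema.min≤xs ℚ⁺-totalOrder ⊤⁺ (completions x)) (∈-map⁺ (λ y → h (x ++ y)) (∈-labelings y))))
    ... | [ p ] | NonStrict⁺.[ p≤q ] = p , ≡.refl , p≤q

module _ {c ℓ₁ ℓ₂} {K : OrderedField c ℓ₁ ℓ₂} where

  open OrderedField K hiding (zero)
  open OrderedFieldProperties K
  open NonStrict⁺ _≤_ using (_≤⁺_)
  open PosetReasoning poset

  𝔼-finite : ∀ {A} (μ : Distribution K A) (φ : A → ℚ ⁺) {b : Vector ℚ (Distribution.size μ)} →
    (∀ s → φ (Distribution.point μ s) ≡ [ b s ]) →
    𝔼 μ φ ≡ [ sum (λ s → Distribution.weight μ s ⊛ ι (b s)) ]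
  𝔼-finite μ φ φ≡b = sum⁺-finite _⊕_ 0# λ s → cong (Maybe.map _) (φ≡b s)

  𝔼-finite⁻¹ : ∀ {A} (μ : Distribution K A) (φ : A → ℚ ⁺) {l} → 𝔼 μ φ ≤⁺ [ l ] →
    ∃[ b ] (∀ s → φ (Distribution.point μ s) ≡ [ b s ]) × sum (λ s → Distribution.weight μ s ⊛ ι (b s)) ≤ l
  𝔼-finite⁻¹ μ φ {l} 𝔼≤l with [ e ] ← 𝔼 μ φ in 𝔼≡e | NonStrict⁺.[ e≤l ] ← 𝔼≤l
    with v , eq , e≡ ← sum⁺-finite⁻¹ _⊕_ 0# 𝔼≡e
    = proj₁ ∘ finite v eq , proj₁ ∘ proj₂ ∘ finite v eq ,
      ≤-trans (≤-reflexive (trans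
        (sum-cong-≋ {_} {λ s → weight s ⊛ ι (proj₁ (finite v eq s))} {v}
          λ s → reflexive (≡.sym (proj₂ (proj₂ (finite v eq s)))))
        (reflexive (≡.sym e≡)))) e≤l
    where
    open Distribution μ
    finite : ∀ v → (∀ s → Maybe.map (λ q → weight s ⊛ ι q) (φ (point s)) ≡ [ v s ]) →
             ∀ s → ∃[ q ] φ (point s) ≡ [ q ] × v s ≡ (weight s ⊛ ι q)
    finite v eq s = map-finite⁻¹ (λ q → weight s ⊛ ι q) (eq s)

  -- Passage from a language to its expressive power

  module _ {d m} (ω : Distribution K (Op d m)) where

    open Distribution ω renaming (point to 𝟙)

    weight≥0 : ∀ s → 0# ≤ weight s
    weight≥0 = proj₁ ∘ weight>0

    -- The common form of (C1), where L and R both average over all m labelings, and (C2),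
    -- where L evaluates at i and R averages over the labelings other than i.
    record Improves (L R : Vector ℚ m → ℚ) {n} (f : CostFn d n) : Set ℓ₂ where
      field
        improve : ∀ x (b : Vector ℚ m) → Values f x b →
          Σ (Fin size → Vector ℚ m) λ a → (∀ s → Values f (𝟙 s ⟨ x ⟩ₙ) (a s)) ×
            sum (λ s → weight s ⊛ ι (L (a s))) ≤ ι (R b)

    open Improves

    module _ {L R} (L-ma : MonotoneAdditive L) (R-ma : MonotoneAdditive R)
      {Γ : Language d} (Γ-improves : ∀ {n} (f : CostFn d n) → (n , f) ∈ Γ → Improves L R f) where

      open MonotoneAdditive

      objective-improves : ∀ {N} (I : Instance Γ N) → Improves L R (objective I)
      objective-improves {N} I@(q , cs) .improve z b objz≡b = (λ s i → sumℚ (λ t → a t s i)) , values , bound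
        where
        restrict : ∀ t → Vec (Labeling d (Constraint.arity (cs t))) m
        restrict t = Vec.map (λ r → Vec.map (lookup r) (Constraint.scope (cs t))) z

        split : ∀ i → Σ (Vector ℚ q) λ v → (∀ t → Constraint.value (cs t) (lookup z i) ≡ [ v t ]) × b i ≡ sumℚ v
        split i = sum⁺-finite⁻¹ ℚ._+_ 0ℚ (objz≡b i)

        bₜ : Fin q → Vector ℚ m
        bₜ t i = proj₁ (split i) t

        improved : ∀ t → Σ (Fin size → Vector ℚ m) λ a →
          (∀ s → Values (Constraint.fn (cs t)) (𝟙 s ⟨ restrict t ⟩ₙ) (a s)) ×
          sum (λ s → weight s ⊛ ι (L (a s))) ≤ ι (R (bₜ t))
        improved t = Γ-improves (Constraint.fn (cs t)) (Constraint.fn∈Γ (cs t)) .improve (restrict t) (bₜ t)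
          λ i → ≡.trans (cong (Constraint.fn (cs t)) (lookup-map i _ z)) (proj₁ (proj₂ (split i)) t)

        a : Fin q → Fin size → Vector ℚ m
        a t = proj₁ (improved t)

        values : ∀ s → Values (objective I) (𝟙 s ⟨ z ⟩ₙ) (λ i → sumℚ (λ t → a t s i))
        values s i = sum⁺-finite ℚ._+_ 0ℚ λ t →
          ≡.trans (cong (Constraint.fn (cs t)) (≡.sym (⟨⟩ₙ-map (𝟙 s) z (Constraint.scope (cs t)) i)))
                  (proj₁ (proj₂ (improved t)) s i)

        -- Additivity turns both sides into sums over the constraints; once the sums over `s` and
        -- `t` are exchanged, the bound holds constraint by constraint.
        bound : sum (λ s → weight s ⊛ ι (L (λ i → sumℚ (λ t → a t s i)))) ≤ ι (R b)
        bound = begin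
          sum (λ s → weight s ⊛ ι (L (λ i → sumℚ (λ t → a t s i)))) ≈⟨ sum-cong-≋ {size} (λ s → trans
              (*-congˡ (trans (reflexive (cong ι (L-sum L-ma (λ t → a t s)))) (ι-sum (λ t → L (a t s)))))
              (*-distribˡ-sum (weight s) (λ t → ι (L (a t s))))) ⟩
          sum (λ s → sum (λ t → weight s ⊛ ι (L (a t s))))          ≈⟨ ∑-comm {size} {q} (λ s t → weight s ⊛ ι (L (a t s))) ⟩
          sum (λ t → sum (λ s → weight s ⊛ ι (L (a t s))))          ≤⟨ sum-mono-≤ {q} (λ t → proj₂ (proj₂ (improved t))) ⟩
          sum (λ t → ι (R (bₜ t)))                                  ≈⟨ ι-sum (λ t → R (bₜ t)) ⟨
          ι (sumℚ (λ t → R (bₜ t)))                                 ≡⟨ cong ι (L-sum R-ma bₜ) ⟨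
          ι (R (λ i → sumℚ (λ t → bₜ t i)))                         ≡⟨ cong ι (L-cong R-ma (λ i → proj₂ (proj₂ (split i)))) ⟨
          ι (R b)                                                   ∎

      -- Each `y` minimises for its own `x`, so the right-hand side is the same vector `b` for `f`
      -- and for the objective. The moved `y` need not minimise for the moved `x`, but it is a
      -- completion, so `f` there is at most the objective, and this is the direction that the
      -- left-hand side tolerates.
      expressible-improves : ∀ {n} {f : CostFn d n} → ⟨ Γ ⟩ f → Improves L R f
      expressible-improves {f = f} (l , I , f≡min) .improve x b fx≡b =
        (λ s i → proj₁ (below s i)) , (λ s i → proj₁ (proj₂ (below s i))) ,
        ≤-trans (sum-mono-≤ {size} λ s → *-monoˡ-≤-nonNeg (weight≥0 s)
                  (ι-mono-≤ (L-mono L-ma (λ i → proj₂ (proj₂ (below s i))))))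
                (proj₂ (proj₂ improved))
        where
        y : Vec (Labeling d l) m
        y = tabulate λ i → proj₁ (min-attained f (objective I) f≡min (fx≡b i))

        z = zipWith _++_ x y

        improved = objective-improves I .improve z b λ i → ≡.trans
          (cong (objective I) (≡.trans (lookup-zipWith _++_ i x y) (cong (lookup x i ++_) (lookup∘tabulate _ i))))
          (proj₂ (min-attained f (objective I) f≡min (fx≡b i)))

        below : ∀ s i → ∃[ p ] f (lookup (𝟙 s ⟨ x ⟩ₙ) i) ≡ [ p ] × p ℚ.≤ proj₁ improved s i
        below s i = min-below f (objective I) f≡min {y = lookup (𝟙 s ⟨ y ⟩ₙ) i} (≡.trans
          (cong (objective I) (≡.trans (≡.sym (lookup-zipWith _++_ i (𝟙 s ⟨ x ⟩ₙ) (𝟙 s ⟨ y ⟩ₙ)))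
                                       (cong (λ r → lookup r i) (⟨⟩ₙ-++ (𝟙 s) x y))))
          (proj₁ (proj₂ improved) s i))

  C1⇒improves : ∀ {d p} (ω : Distribution K (Op d (suc p))) {n} (f : CostFn d n) →
    C1 ω f → Improves ω (mean id) (mean id) f
  C1⇒improves ω f C1-f .Improves.improve x b fx≡b =
    let e , avg≡e , bound = 𝔼-finite⁻¹ ω (λ 𝟙ˢ → avg f (𝟙ˢ ⟨ x ⟩ₙ))
          (subst (λ r → 𝔼 ω (λ 𝟙ˢ → avg f (𝟙ˢ ⟨ x ⟩ₙ)) ≤⁺ Maybe.map ι r) (avg-finite f x fx≡b x id (λ _ → ≡.refl))
            (C1-f x (lookup⁻ λ i → finite⇒Dom {f = f} (fx≡b i))))
        a s = avg-finite⁻¹ f (Distribution.point ω s ⟨ x ⟩ₙ) (avg≡e s)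
    in  (λ s → proj₁ (a s)) , (λ s → proj₁ (proj₂ (a s))) ,
        ≤-trans (≤-reflexive (sum-cong-≋ {_} {λ s → Distribution.weight ω s ⊛ ι (mean id (proj₁ (a s)))} {λ s → Distribution.weight ω s ⊛ ι (e s)}
          λ s → *-congˡ (reflexive (cong ι (≡.sym (proj₂ (proj₂ (a s)))))))) bound

  -- (C2) at a fixed `i` controls only the `i`-th labeling; the finiteness of all m labelings is
  -- taken from (C1).
  C2⇒improves : ∀ {d p} (ω : Distribution K (Op d (suc (suc p)))) {n} (f : CostFn d n) →
    C1 ω f → C2 ω f → ∀ i → Improves ω (λ u → u i) (mean (punchIn i)) f
  C2⇒improves ω f C1-f C2-f i .Improves.improve x b fx≡b =
    let a , fsx≡a , _ = C1⇒improves ω f C1-f .Improves.improve x b fx≡b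
    in  a , fsx≡a , NonStrict⁺.[≤]-injective _
          (≡.subst₂ _≤⁺_ (𝔼-finite ω (λ 𝟙ˢ → f (lookup (𝟙ˢ ⟨ x ⟩ₙ) i)) (λ s → fsx≡a s i))
            (cong (Maybe.map ι) (avg-finite f x fx≡b (removeAt x i) (punchIn i) (lookup-removeAt x i)))
            (C2-f x (lookup⁻ λ i → finite⇒Dom {f = f} (fx≡b i)) i))

  -- Distributions from nonnegative weights, and the case of equality

  0<⇒≉0 : ∀ {w} → 0# < w → ¬ w ≈ 0#
  0<⇒≉0 (_ , 0≉w) = 0≉w ∘ sym

  -- A stationary vector may vanish at transient states, whereas a `Distribution` has positive
  -- weights. Dropping the zero entries changes no weighted sum.
  positive-part : ∀ {n} (π : Vector Carrier n) → (∀ j → 0# ≤ π j) →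
    ∃[ k ] Σ (Fin k → Fin n) λ σ → (∀ i → 0# < π (σ i)) ×
      (∀ (u : Vector Carrier n) → sum (λ i → π (σ i) ⊛ u (σ i)) ≈ sum (λ j → π j ⊛ u j))
  positive-part {zero}  π 0≤π = 0 , (λ ()) , (λ ()) , λ u → refl
  positive-part {suc n} π 0≤π with positive-part (π ∘ suc) (0≤π ∘ suc) | 0# ≟ π zero
  ... | k , σ , 0<πσ , same | yes 0≈π₀ = k , suc ∘ σ , 0<πσ , λ u →
    trans (same (u ∘ suc)) (trans (sym (+-identityˡ _)) (+-congʳ (trans (sym (zeroˡ (u zero))) (*-congʳ 0≈π₀))))
  ... | k , σ , 0<πσ , same | no 0≉π₀ =
    suc k , (λ { zero → zero ; (suc i) → suc (σ i) }) ,
    (λ { zero → 0≤π zero , 0≉π₀ ; (suc i) → 0<πσ i }) , λ u → +-congˡ (same (u ∘ suc))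

  distribution : ∀ {A : Set} {n} (π : Vector Carrier n) → (∀ j → 0# ≤ π j) → sum π ≈ 1# → (points : Fin n → A) →
    Σ (Distribution K A) λ μ → ∀ (φ : A → ℚ ⁺) (b : Vector ℚ n) → (∀ j → φ (points j) ≡ [ b j ]) →
      ∃[ e ] 𝔼 μ φ ≡ [ e ] × e ≈ sum (λ j → π j ⊛ ι (b j))
  distribution {n = n} π 0≤π Σπ≈1 points with positive-part π 0≤π
  ... | k , σ , 0<πσ , same = μ , λ φ b φ≡b → _ , 𝔼-finite μ φ (φ≡b ∘ σ) , same (ι ∘ b)
    where
    μ = record
      { size = k ; point = points ∘ σ ; weight = π ∘ σ ; weight>0 = 0<πσ
      ; total≈1 = begin-equality
          sum (π ∘ σ)                  ≈⟨ sum-cong-≋ {k} (λ i → *-identityʳ (π (σ i))) ⟨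
          sum (λ i → π (σ i) ⊛ 1#)     ≈⟨ same (λ _ → 1#) ⟩
          sum (λ j → π j ⊛ 1#)         ≈⟨ sum-cong-≋ {n} (λ j → *-identityʳ (π j)) ⟩
          sum π                        ≈⟨ Σπ≈1 ⟩
          1#                           ∎ }

  below-mean⇒equal : ∀ {p} (u : Vector Carrier (suc (suc p))) →
    (∀ i → u i ≤ sum (λ k → ι (ℤ.+ 1 ℚ./ suc p) ⊛ u (punchIn i k))) → ∀ i j → u i ≈ u j
  below-mean⇒equal {p} u u≤mean i j = trans (sym (equals-max i)) (equals-max j)
    where
    r = ι (ℤ.+ 1 ℚ./ suc p)

    0≤r : 0# ≤ r
    0≤r = ≤-trans (≤-reflexive (sym 0#-homo))
      (ι-mono-≤ (ℚ.nonNegative⁻¹ (ℤ.+ 1 ℚ./ suc p) ⦃ ℚ.normalize-nonNeg 1 (suc p) ⦄))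

    Σr≈1 : sum {suc p} (λ _ → r) ≈ 1#
    Σr≈1 = trans (sym (ι-sum {suc p} (λ _ → ℤ.+ 1 ℚ./ suc p))) (trans (ι-cong (sumℚ-1/ p)) 1#-homo)

    r≉0 : ¬ r ≈ 0#
    r≉0 r≈0 = 0≉1 (trans (sym (sum-zero {suc p} (λ _ → r≈0))) Σr≈1)

    maximum : ∃[ i₀ ] ∀ j → u j ≤ u i₀
    maximum = extremal {_≲_ = flip _≤_} (flip total) (flip ≤-trans) zero u

    i₀ = proj₁ maximum
    u≤max = proj₂ maximum

    -- No other entry exceeds the maximum, yet their mean is at least the maximum. The factor `r`
    -- stays inside the sum so that `sum-squeeze` compares term by term, and it is cancelled
    -- afterwards.
    others : ∀ k → (r ⊛ u (punchIn i₀ k)) ≈ (r ⊛ u i₀)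
    others = sum-squeeze (λ k → *-monoˡ-≤-nonNeg 0≤r (u≤max (punchIn i₀ k))) (begin
      sum {suc p} (λ _ → r ⊛ u i₀)          ≈⟨ *-distribʳ-sum {suc p} (u i₀) (λ _ → r) ⟨
      sum {suc p} (λ _ → r) ⊛ u i₀          ≈⟨ *-congʳ Σr≈1 ⟩
      1# ⊛ u i₀                             ≈⟨ *-identityˡ (u i₀) ⟩
      u i₀                                  ≤⟨ u≤mean i₀ ⟩
      sum (λ k → r ⊛ u (punchIn i₀ k))      ∎)

    equals-max : ∀ j → u i₀ ≈ u j
    equals-max j with i₀ Fin.≟ j
    ... | yes ≡.refl = refl
    ... | no  i₀≢j   = subst (λ l → u i₀ ≈ u l) (punchIn-punchOut i₀≢j)
                         (sym (*-cancelˡ-≉0 r≉0 (others (Fin.punchOut i₀≢j))))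

  -- Costs along an orbit

  module _ {d m} (ω : Distribution K (Op d m)) where

    open Distribution ω renaming (point to 𝟙)

    compose-finite : ∀ {L R n} {f : CostFn d n} → Improves ω L R f →
      ∀ x (b : Vector ℚ m) → Values f x b → ∀ w → ∃ (Values f (compose ω w ⟨ x ⟩ₙ))
    compose-finite {f = f} improves x b fx≡b []      = b , subst (λ y → Values f y b) (⟨⟩ₙ-id x) fx≡b
    compose-finite {f = f} improves x b fx≡b (s ∷ w) =
      let a , fwx≡a = compose-finite improves x b fx≡b w
          a′ , fswx≡a′ , _ = improves .Improves.improve (compose ω w ⟨ x ⟩ₙ) a fwx≡a
      in  a′ s , subst (λ y → Values f y (a′ s)) (⟨⟩ₙ-∘ (𝟙 s) (λ _ → ≡.refl) x) (fswx≡a′ s)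

    module _ {g} (O : Orbit ω g) where

      open Orbit O

      -- The values that `improve` supplies after `𝟙 s` are those already recorded at `next s j`,
      -- because a finite cost has only one value. The condition thus becomes an inequality for
      -- functions on the finite index set.
      orbit-improves : ∀ {L R n} {f : CostFn d n} → MonotoneAdditive L → Improves ω L R f →
        ∀ (x : Vec (Labeling d n) m) (b : Fin count → Vector ℚ m) → (∀ j → Values f (elem j ⟨ x ⟩ₙ) (b j)) →
        ∀ j → sum (λ s → weight s ⊛ ι (L (b (next s j)))) ≤ ι (R (b j))
      orbit-improves {L} {f = f} L-ma improves x b fx≡b j =
        let a , fsx≡a , bound = improves .Improves.improve (elem j ⟨ x ⟩ₙ) (b j) (fx≡b j)
            same s i = just-injective (≡.trans (≡.sym (fx≡b (next s j) i))
              (≡.trans (cong (λ y → f (lookup y i)) (≡.sym (⟨⟩ₙ-∘ (𝟙 s) (elem-next s j) x))) (fsx≡a s i)))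
        in  ≤-trans (≤-reflexive (sum-cong-≋ {size} λ s → *-congˡ
              (reflexive (cong ι (MonotoneAdditive.L-cong L-ma (same s)))))) bound

      -- Constancy is claimed on the states reachable from a minimiser. Along a word the current
      -- state is again a minimiser, so the same squeeze applies, and each positive weight can be
      -- cancelled.
      minimum-principle : (F : Fin count → ℚ) → (∀ j → sum (λ s → weight s ⊛ ι (F (next s j))) ≤ ι (F j)) →
        ∃[ j ] ∀ w → F (Automaton.run next w j) ≡ F j
      minimum-principle F superharmonic = j₀ , constant
        where
        minimum : ∃[ j₀ ] ∀ j → ι (F j₀) ≤ ι (F j)
        minimum = extremal {_≲_ = _≤_} total ≤-trans origin (ι ∘ F)

        j₀ = proj₁ minimum
        F≥min = proj₂ minimum

        constant : ∀ w → F (Automaton.run next w j₀) ≡ F j₀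
        constant []      = ≡.refl
        constant (s ∷ w) = ≡.sym (ι-injective (*-cancelˡ-≉0 (0<⇒≉0 (weight>0 s))
          (sum-squeeze (λ s → *-monoˡ-≤-nonNeg (weight≥0 ω s) (F≥min (next s j))) (begin
            sum (λ s → weight s ⊛ ι (F (next s j))) ≤⟨ superharmonic j ⟩
            ι (F j)                                 ≡⟨ cong ι (constant w) ⟩
            ι (F j₀)                                ≈⟨ *-identityˡ _ ⟨
            1# ⊛ ι (F j₀)                           ≈⟨ *-congʳ total≈1 ⟨
            sum weight ⊛ ι (F j₀)                   ≈⟨ *-distribʳ-sum (ι (F j₀)) weight ⟩
            sum (λ s → weight s ⊛ ι (F j₀))         ∎) s)))
          where j = Automaton.run next w j₀

  -- Constancy of the average cost, and the equalising distribution

  avg-invariant : ∀ {d p} (ω : Distribution K (Op d (suc p))) {n} (f : CostFn d n) →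
    Improves ω (mean id) (mean id) f → ∀ x → Range ω n x → All (Dom f) x →
    ∀ g → 𝔾 ω g → avg f (g ⟨ x ⟩ₙ) ≡ avg f x
  avg-invariant ω f improves x (g* , g*∈𝔾* , y , ≡.refl) = along-orbit (orbit ω g*)
   where
   along-orbit : Orbit ω g* → All (Dom f) (g* ⟨ y ⟩ₙ) → ∀ g → 𝔾 ω g →
     avg f (g ⟨ g* ⟨ y ⟩ₙ ⟩ₙ) ≡ avg f (g* ⟨ y ⟩ₙ)
   along-orbit O x∈dom g (v , g≗) =
    ≡.trans (≡.trans (cong (avg f) (≡.trans (⟨⟩ₙ-∘ g {g*} (λ _ → ≡.refl) y) along-v)) (avg-run (v List.++ u)))
            (≡.sym (≡.trans (cong (avg f) along-u) (avg-run u)))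
    where
    open Orbit O

    -- `y` itself may lie outside the domain. Finiteness is therefore carried from `g* ⟨ y ⟩ₙ` along
    -- the word that leads from `g*` to `elem j`.
    finite : ∀ j → ∃ (Values f (elem j ⟨ y ⟩ₙ))
    finite j =
      let w , elem≗ = elem-word j
          b , fwx≡b = compose-finite ω improves (g* ⟨ y ⟩ₙ) _ (proj₂ (Dom⇒values f x∈dom)) w
      in  b , subst (λ z → Values f z b) (⟨⟩ₙ-∘ (compose ω w) elem≗ y) fwx≡b

    F : Fin count → ℚ
    F j = mean id (proj₁ (finite j))

    minimal = minimum-principle ω O F
      (orbit-improves ω O (mean-monotoneAdditive id) improves y (proj₁ ∘ finite) (proj₂ ∘ finite))

    j₀ = proj₁ minimal

    avg-run : ∀ w → avg f (elem (Automaton.run next w j₀) ⟨ y ⟩ₙ) ≡ [ F j₀ ]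
    avg-run w = ≡.trans
      (let y′ = elem (Automaton.run next w j₀) ⟨ y ⟩ₙ in
       avg-finite f y′ (proj₂ (finite (Automaton.run next w j₀))) y′ id (λ _ → ≡.refl))
      (cong [_] (proj₂ minimal w))

    w₀ = proj₁ (elem-word j₀)

    -- The minimiser need not be `g*`: `w₀` leads from `g*` to it, and as `g*` lies in a closed
    -- component some `u` leads back. Both `g*` and `g ∘ g*` are then reachable from the minimiser,
    -- by `u` and by `v List.++ u`.
    back : ∃[ u ] g* ≗ compose ω u ∘ compose ω w₀ ∘ g*
    back = 𝔾*⇒returning ω g*∈𝔾* w₀

    u = proj₁ back

    g*≗elem : g* ≗ elem (Automaton.run next u j₀)
    g*≗elem z = ≡.trans (proj₂ back z) (≡.sym
      (≡.trans (elem-run u j₀ z) (cong (compose ω u) (proj₂ (elem-word j₀) z))))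

    along-u : g* ⟨ y ⟩ₙ ≡ elem (Automaton.run next u j₀) ⟨ y ⟩ₙ
    along-u = ⟨⟩ₙ-ext (elem (Automaton.run next u j₀)) y λ a → ≡.trans (column-⟨⟩ₙ g* y a) (g*≗elem (column a y))

    along-v : (g ∘ g*) ⟨ y ⟩ₙ ≡ elem (Automaton.run next (v List.++ u) j₀) ⟨ y ⟩ₙ
    along-v = ⟨⟩ₙ-ext (elem (Automaton.run next (v List.++ u) j₀)) y λ a →
      ≡.trans (column-⟨⟩ₙ (g ∘ g*) y a) (let z = column a y in
      ≡.trans (g≗ (g* z)) (≡.trans (cong (compose ω v) (≡.trans (g*≗elem z) (elem-run u j₀ z)))
      (≡.sym (≡.trans (elem-run (v List.++ u) j₀ z) (compose-++ ω v u (elem j₀ z))))))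

  equalising : ∀ {d p} (ω : Distribution K (Op d (suc (suc p)))) {g} → 𝔾* ω g → Orbit ω g →
    Σ (Distribution K (∃ (𝔾* ω))) λ μ → ∀ {n} (f : CostFn d n) →
      (∀ i → Improves ω (λ u → u i) (mean (punchIn i)) f) →
      ∀ x → All (Dom f) x → ∀ i′ i″ → _≈⁺_ {K = K} (expectedCost ω μ f i′ x) (expectedCost ω μ f i″ x)
  equalising {d} {p} ω {g} g∈𝔾* O = proj₁ μ,𝔼 , equal
    where
    open Distribution ω using (weight; size; total≈1)
    open Orbit O

    stationary = RandomMap.invariant weight (weight≥0 ω) total≈1 next origin
    π = proj₁ stationary
    0≤π = proj₁ (proj₂ stationary)
    π-invariant = proj₂ (proj₂ (proj₂ stationary))

    -- `π` comes from `ω` and the orbit alone, so the distribution is fixed before `f` and `x`. Its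
    -- points lie in `𝔾*` because words applied to a member of `𝔾*` do not leave `𝔾*`.
    μ,𝔼 = distribution π 0≤π (proj₁ (proj₂ (proj₂ stationary)))
      λ j → elem j , 𝔾*-compose ω g∈𝔾* (proj₁ (elem-word j)) (proj₂ (elem-word j))

    equal : ∀ {n} (f : CostFn d n) → (∀ i → Improves ω (λ u → u i) (mean (punchIn i)) f) →
      ∀ x → All (Dom f) x → ∀ i′ i″ →
      _≈⁺_ {K = K} (expectedCost ω (proj₁ μ,𝔼) f i′ x) (expectedCost ω (proj₁ μ,𝔼) f i″ x)
    equal f improves x x∈dom i′ i″ =
      let e′ , 𝔼≡e′ , e′≈ = expected i′
          e″ , 𝔼≡e″ , e″≈ = expected i″
      in  ≡.subst₂ (_≈⁺_ {K = K}) (≡.sym 𝔼≡e′) (≡.sym 𝔼≡e″)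
            Equality⁺.[ trans e′≈ (trans (below-mean⇒equal u below-mean i′ i″) (sym e″≈)) ]
      where
      finite : ∀ j → ∃ (Values f (elem j ⟨ x ⟩ₙ))
      finite j =
        let w , elem≗ = elem-word j
            w₀ , g≗   = proj₁ g∈𝔾*
            b , fwx≡b = compose-finite ω (improves zero) x _ (proj₂ (Dom⇒values f x∈dom)) (w List.++ w₀)
        in  b , subst (λ z → Values f z b)
              (⟨⟩ₙ-ext (elem j) x λ a → ≡.trans (column-⟨⟩ₙ (compose ω (w List.++ w₀)) x a)
                (≡.trans (compose-++ ω w w₀ _) (≡.sym (≡.trans (elem≗ _) (cong (compose ω w) (g≗ _)))))) fwx≡b

      b : Fin count → Vector ℚ (suc (suc p))
      b = proj₁ ∘ finite

      u : Vector Carrier (suc (suc p))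
      u i = sum (λ j → π j ⊛ ι (b j i))

      expected : ∀ i → ∃[ e ] expectedCost ω (proj₁ μ,𝔼) f i x ≡ [ e ] × e ≈ u i
      expected i = proj₂ μ,𝔼 (λ (g , _) → f (lookup (g ⟨ x ⟩ₙ) i)) (λ j → b j i) (λ j → proj₂ (finite j) i)

      r = ℤ.+ 1 ℚ./ suc p

      -- Invariance of `π` for the test function `j ↦ ι (b j i)` inserts one more random step, which
      -- is the step that (C2) bounds. The remaining lines move the factor 1/(m-1) and the sum over
      -- the other labelings outside.
      below-mean : ∀ i → u i ≤ sum (λ k → ι r ⊛ u (punchIn i k))
      below-mean i = begin
        u i
          ≈⟨ π-invariant (λ j → ι (b j i)) ⟨
        sum (λ j → π j ⊛ sum (λ s → weight s ⊛ ι (b (next s j) i)))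
          ≤⟨ sum-mono-≤ {count} (λ j → *-monoˡ-≤-nonNeg (0≤π j)
               (orbit-improves ω O (eval-monotoneAdditive i) (improves i) x b (proj₂ ∘ finite) j)) ⟩
        sum (λ j → π j ⊛ ι (mean (punchIn i) (b j)))
          ≈⟨ sum-cong-≋ {count} (λ j → *-congˡ (trans (*-homo r _)
               (trans (*-congˡ (ι-sum (b j ∘ punchIn i))) (*-comm (ι r) _)))) ⟩
        sum (λ j → π j ⊛ (sum (λ k → ι (b j (punchIn i k))) ⊛ ι r))
          ≈⟨ sum-cong-≋ {count} (λ j → *-assoc (π j) _ (ι r)) ⟨
        sum (λ j → (π j ⊛ sum (λ k → ι (b j (punchIn i k)))) ⊛ ι r)
          ≈⟨ *-distribʳ-sum (ι r) (λ j → π j ⊛ sum (λ k → ι (b j (punchIn i k)))) ⟨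
        sum (λ j → π j ⊛ sum (λ k → ι (b j (punchIn i k)))) ⊛ ι r
          ≈⟨ *-congʳ (sum-cong-≋ {count} λ j → *-distribˡ-sum (π j) (λ k → ι (b j (punchIn i k)))) ⟩
        sum (λ j → sum (λ k → π j ⊛ ι (b j (punchIn i k)))) ⊛ ι r
          ≈⟨ *-congʳ (∑-comm {count} {suc p} (λ j k → π j ⊛ ι (b j (punchIn i k)))) ⟩
        sum (λ k → u (punchIn i k)) ⊛ ι r
          ≈⟨ *-comm _ (ι r) ⟩
        ι r ⊛ sum (λ k → u (punchIn i k))
          ≈⟨ *-distribˡ-sum (ι r) (λ k → u (punchIn i k)) ⟩
        sum (λ k → ι r ⊛ u (punchIn i k)) ∎

theorem5p4 : ∀ {c ℓ₁ ℓ₂} (K : OrderedField c ℓ₁ ℓ₂) (d p : ℕ) →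
    let m = suc (suc p) in
    (Γ : Language d) (ω : Distribution K (Op d m)) →
    (∀ {n} (f : CostFn d n) → (n , f) ∈ Γ → C1 ω f) →
    (∀ {n} (f : CostFn d n) → ⟨ Γ ⟩ f →
    ∀ (x : Vec (Labeling d n) m) → Range ω n x → All (Dom f) x →
    ∀ (g : Op d m) → 𝔾 ω g → avg f (g ⟨ x ⟩ₙ) ≡ avg f x)
    ×
    ((∀ {n} (f : CostFn d n) → (n , f) ∈ Γ → C2 ω f) →
    Σ (Distribution K (∃ (𝔾* ω))) λ μ →
    ∀ {n} (f : CostFn d n) → ⟨ Γ ⟩ f →
    ∀ (x : Vec (Labeling d n) m) → Range ω n x → All (Dom f) x →
    ∀ (i′ i″ : Fin m) →
    _≈⁺_ {K = K} (expectedCost ω μ f i′ x) (expectedCost ω μ f i″ x))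
theorem5p4 K d p Γ ω C1-Γ =
  (λ f f∈⟨Γ⟩ → avg-invariant ω f
    (expressible-improves ω mean-ma mean-ma (λ f f∈Γ → C1⇒improves ω f (C1-Γ f f∈Γ)) f∈⟨Γ⟩)) ,
  λ C2-Γ → let μ , equal = equalising ω (proj₂ (∃𝔾* ω)) (orbit ω _) in
    μ , λ f f∈⟨Γ⟩ x _ → equal f
      (λ i → expressible-improves ω (eval-monotoneAdditive i) (mean-monotoneAdditive (punchIn i))
        (λ f f∈Γ → C2⇒improves ω f (C1-Γ f f∈Γ) (C2-Γ f f∈Γ) i) f∈⟨Γ⟩) x
  where mean-ma = mean-monotoneAdditive id
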